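{- Let $p$ be an odd prime, $2\le m\le n-1$, $n\ge3$, $1\le t\le p-1$, and let $I$ be the saturated generalized order ideal of $\mathbb{GH}(m,n)$ in which each element of $[m]$ has multiplicity $p-1$, the single upper element $m+1$ has multiplicity $t$, and all other elements have multiplicity $0$, so that \[ I(\mathbb{GP})=(\mathbb{F}_p^m\times0)\cup\{(-1,\dots,-1,j,0,\dots,0):1\le j\le t\}\subseteq\mathbb{F}_p^n \] (with $m$ entries equal to $-1$). Let $D=\mathbb{F}_p^n\setminus I(\mathbb{GP})$. Then $\mathcal{C}_D$ is a Griesmer code with parameters \[ \big[p^n-p^m-t,\ n,\ (p-1)(p^{n-1}-p^{m-1})-t\big]_p . \] Writing $d=(p-1)(p^{n-1}-p^{m-1})-t$ for the minimum distance and $c=p^{n-m-1}$, its nonzero weights and their frequencies (frequencies being added for rows with equal weight) are \[ \begin{array}{ll} \text{weight} & \text{frequency}\\ d & (p-1)c\,\big((p-t+1)p^{m-1}-1\big)\\ d+1 & (p-1)c\,t\,p^{m-1}\\ (p-1)(p^{n-1}-p^{m-1}) & (p^{m-1}-1)c\\ (p-1)p^{n-1}-t & (p-1)c\\ (p-1)p^{n-1} & c-1 \end{array} \] For $t\ge2$ these are five distinct weights if $m\le n-2$ and four if $m=n-1$; for $t=1$ the second and third rows coincide, giving four distinct weights if $m\le n-2$ and three if $m=n-1$. In all cases $\mathcal{C}_D$ is minimal if and only if $m\le n-2$.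
   Context: $[n]=\{1,\dots,n\}$. For $D\subseteq\mathbb{F}_p^n$, $\mathcal{C}_D=\{c_D(u)=(u\cdot x)_{x\in D}:u\in\mathbb{F}_p^n\}$, where $u\cdot x=\sum_i u_ix_i$. An $[N,k,d]_p$ code is a linear code over $\mathbb{F}_p$ of length $N$, dimension $k$, minimum Hamming distance $d$; it is a Griesmer code if $N=\sum_{i=0}^{k-1}\lceil d/p^i\rceil$. A row with frequency $0$ does not contribute a weight. A nonzero codeword $c$ of a linear code $\mathcal{C}$ over $\mathbb{F}_p$ is minimal if $c'\in\mathcal{C}$ and $\mathrm{supp}(c')\subseteq\mathrm{supp}(c)$ imply $c'\in\mathbb{F}_pc$; $\mathcal{C}$ is minimal if all its nonzero codewords are. Generalized order ideals: $[n]_{p-1}$ is the multiset in which each $i\in[n]$ has multiplicity $p-1$. A sub-multiset $J$ is identified with its multiplicity vector $(J_1,\dots,J_n)\in\{0,\dots,p-1\}^n=\mathbb{F}_p^n$; $J\subseteq J'$ means $J_i\le J'_i$ (as integers) for all $i$; $\bar J=\{i:J_i\ne0\}$. The hierarchical poset $\mathbb{H}(m,n)$ on $[n]$ has as its only strict relations $i\prec j$ for all $i\in[m]$, $j\in[n]\setminus[m]$; $\mathbb{GH}(m,n)$ denotes $[n]_{p-1}$ together with this order. $J$ is a saturated generalized order ideal if $\bar J$ is an order ideal (down-closed subset) of $\mathbb{H}(m,n)$ and $J_i=p-1$ whenever $j\in\bar J$ and $i\prec j$. For a saturated generalized order ideal $I$, $I(\mathbb{GP})\subseteq\mathbb{F}_p^n$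 is the set of all saturated generalized order ideals contained in $I$. -}

module Defs where

open import Level using (0ℓ)
open import Data.Nat.Base using (ℕ; zero; suc; _+_; _*_; _∸_; _^_; _/_; _≤_; _<_; NonZero)
open import Data.Nat.DivMod using (_mod_)
open import Data.Nat.Properties as ℕ using (m^n≢0; <-cmp)
open import Data.Fin.Base as Fin using (Fin; toℕ)
open import Data.Fin.Properties as Fin using (all?)
open import Data.Fin.Subset using (Subset; _∈_; _⊆_; ∣_∣)
open import Data.Fin.Subset.Properties using (_∈?_)
open import Data.Vec.Base as Vec using (Vec; []; _∷_; lookup; tabulate; zipWith; replicate)
open import Data.List.Base as List using (List; length; filter; upTo; allFin; cartesianProductWith)
open import Data.Nat.ListAction using (sum)
import Data.List.Membership.Propositional as List
open import Data.List.Relation.Unary.Unique.Propositional using (Unique)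
open import Data.Product.Base using (∃; _×_; _,_; proj₁; proj₂)
open import Data.Sum.Base using (_⊎_)
open import Function.Bundles using (_⇔_)
open import Relation.Binary.Definitions using (tri<; tri≈; tri>)
open import Relation.Binary.PropositionalEquality.Core using (_≡_; _≢_)
open import Relation.Nullary.Decidable using (Dec; ⌊_⌋; ¬?; _×-dec_; _⊎-dec_; _→-dec_)
open import Relation.Unary using (Pred; Decidable)

HasSize : {A : Set} → Pred A 0ℓ → ℕ → Set
HasSize {A} P k = ∃ λ (xs : List A) →
  Unique xs × (∀ x → x List.∈ xs ⇔ P x) × length xs ≡ k

------------------------------------------------------------------------
-- The prime field 𝔽ₚ = {0, …, p-1} (arithmetic modulo p) and the spaces 𝔽ₚⁿ

𝔽^ : ℕ → ℕ → Set
𝔽^ p n = Vec (Fin p) n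

module _ {p : ℕ} .{{_ : NonZero p}} where

  0ₚ 1ₚ : Fin p
  0ₚ = 0 mod p
  1ₚ = 1 mod p

  infixl 6 _+ₚ_
  infixl 7 _*ₚ_
  infix  8 -ₚ_

  _+ₚ_ _*ₚ_ : Fin p → Fin p → Fin p
  x +ₚ y = (toℕ x + toℕ y) mod p
  x *ₚ y = (toℕ x * toℕ y) mod p

  -ₚ_ : Fin p → Fin p
  -ₚ x = (p ∸ toℕ x) mod p

  infixl 6 _⊕_
  infixl 7 _⊙_ _·_

  0ᵥ : ∀ {n} → 𝔽^ p n
  0ᵥ = replicate _ 0ₚ

  _⊕_ : ∀ {n} → 𝔽^ p n → 𝔽^ p n → 𝔽^ p n
  _⊕_ = zipWith _+ₚ_

  _⊙_ : ∀ {n} → Fin p → 𝔽^ p n → 𝔽^ p n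
  a ⊙ v = Vec.map (a *ₚ_) v

  _·_ : ∀ {n} → 𝔽^ p n → 𝔽^ p n → Fin p
  u · x = Vec.foldr′ _+ₚ_ 0ₚ (zipWith _*ₚ_ u x)

  lincomb : ∀ {k n} → 𝔽^ p k → Vec (𝔽^ p n) k → 𝔽^ p n
  lincomb a b = Vec.foldr′ _⊕_ 0ᵥ (zipWith _⊙_ a b)

  -- The set {i : vᵢ ≠ 0}: the support of a codeword, and also the set J̄ of a
  -- multiplicity vector J.
  supp : ∀ {n} → 𝔽^ p n → Subset n
  supp v = Vec.map (λ x → ⌊ ¬? (x Fin.≟ 0ₚ) ⌋) v

  wt : ∀ {n} → 𝔽^ p n → ℕ
  wt v = ∣ supp v ∣

  hamming : ∀ {n} → 𝔽^ p n → 𝔽^ p n → ℕ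
  hamming v w = ∣ zipWith (λ x y → ⌊ ¬? (x Fin.≟ y) ⌋) v w ∣

------------------------------------------------------------------------
-- Linear codes

  record IsLinear {N} (C : Pred (𝔽^ p N) 0ℓ) : Set where
    field
      0∈  : C 0ᵥ
      ⊕-closed : ∀ {c c′} → C c → C c′ → C (c ⊕ c′)
      ⊙-closed : ∀ a {c} → C c → C (a ⊙ c)

  record IsBasis {N k} (C : Pred (𝔽^ p N) 0ℓ) (b : Vec (𝔽^ p N) k) : Set where
    field
      members     : ∀ i → C (lookup b i)
      independent : ∀ a → lincomb a b ≡ 0ᵥ → a ≡ 0ᵥ
      spanning    : ∀ c → C c → ∃ λ a → c ≡ lincomb a b

  HasDimension : ∀ {N} → Pred (𝔽^ p N) 0ℓ → ℕ → Set
  HasDimension {N} C k = ∃ λ (b : Vec (𝔽^ p N) k) → IsBasis C b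

  record HasMinDistance {N} (C : Pred (𝔽^ p N) 0ℓ) (d : ℕ) : Set where
    field
      attained : ∃ λ c → ∃ λ c′ → C c × C c′ × c ≢ c′ × hamming c c′ ≡ d
      bound    : ∀ c c′ → C c → C c′ → c ≢ c′ → d ≤ hamming c c′

  record Is[_,_,_]Code (N k d : ℕ) {N′ : ℕ} (C : Pred (𝔽^ p N′) 0ℓ) : Set where
    field
      linear      : IsLinear C
      codeLength  : N′ ≡ N
      dimension   : HasDimension C k
      minDistance : HasMinDistance C d

  ⌈_/_⌉ : (a b : ℕ) .{{_ : NonZero b}} → ℕ
  ⌈ a / b ⌉ = (a + (b ∸ 1)) / b

  record IsGriesmer[_,_,_] (N k d : ℕ) {N′ : ℕ} (C : Pred (𝔽^ p N′) 0ℓ) : Set where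
    field
      isCode   : Is[ N , k , d ]Code C
      griesmer : N ≡ sum (List.map (λ i → ⌈ d / p ^ i ⌉ {{m^n≢0 p i}}) (upTo k))

  -- For every w the number of nonzero codewords of weight w is the sum of the
  -- frequencies of the rows (weight , frequency) whose weight is w; it is 0 if
  -- there is no such row or all these rows have frequency 0.
  HasNonzeroWeights : ∀ {N} → Pred (𝔽^ p N) 0ℓ → List (ℕ × ℕ) → Set
  HasNonzeroWeights C rows = ∀ w →
    HasSize (λ c → C c × c ≢ 0ᵥ × wt c ≡ w)
            (sum (List.map proj₂ (filter (λ row → proj₁ row ℕ.≟ w) rows)))

  IsNonzeroWeight : ∀ {N} → Pred (𝔽^ p N) 0ℓ → Pred ℕ 0ℓ
  IsNonzeroWeight C w = ∃ λ c → C c × c ≢ 0ᵥ × wt c ≡ w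

  IsMinimalWord : ∀ {N} → Pred (𝔽^ p N) 0ℓ → Pred (𝔽^ p N) 0ℓ
  IsMinimalWord C c =
    C c × c ≢ 0ᵥ × (∀ c′ → C c′ → supp c′ ⊆ supp c → ∃ λ a → c′ ≡ a ⊙ c)

  IsMinimal : ∀ {N} → Pred (𝔽^ p N) 0ℓ → Set
  IsMinimal C = ∀ c → C c → c ≢ 0ᵥ → IsMinimalWord C c

------------------------------------------------------------------------
-- The code 𝒞_D of a set D ⊆ 𝔽ₚⁿ

allVectors : ∀ p n → List (𝔽^ p n)
allVectors p zero    = List.[ [] ]
allVectors p (suc n) = cartesianProductWith _∷_ (allFin p) (allVectors p n)

-- A subset D of 𝔽ₚⁿ is given by a decision procedure; codewords (u · x)_{x ∈ D}
-- are written with the elements of D in lexicographic order.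
elements : ∀ {p n} {D : Pred (𝔽^ p n) 0ℓ} → Decidable D → List (𝔽^ p n)
elements D? = filter D? (allVectors _ _)

module _ {p : ℕ} .{{_ : NonZero p}} {n : ℕ} {D : Pred (𝔽^ p n) 0ℓ} (D? : Decidable D) where

  codeword : 𝔽^ p n → 𝔽^ p (length (elements D?))
  codeword u = Vec.map (u ·_) (Vec.fromList (elements D?))

  𝒞 : Pred (𝔽^ p (length (elements D?))) 0ℓ
  𝒞 c = ∃ λ u → c ≡ codeword u

------------------------------------------------------------------------
-- The hierarchical poset ℍ(m,n) on [n] and saturated generalized order ideals.
-- The element i ∈ [n] is the index with toℕ = i - 1, so [m] consists of the
-- indices with toℕ < m, and m + 1 is the index with toℕ = m.

module _ (m : ℕ) {n : ℕ} where

  _≺_ _≼_ : Fin n → Fin n → Set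
  i ≺ j = toℕ i < m × m ≤ toℕ j
  i ≼ j = i ≡ j ⊎ i ≺ j

  _≺?_ : ∀ i j → Dec (i ≺ j)
  i ≺? j = (toℕ i ℕ.<? m) ×-dec (m ℕ.≤? toℕ j)

  _≼?_ : ∀ i j → Dec (i ≼ j)
  i ≼? j = (i Fin.≟ j) ⊎-dec (i ≺? j)

  IsOrderIdeal : Subset n → Set
  IsOrderIdeal S = ∀ i j → i ≼ j → j ∈ S → i ∈ S

module _ {p : ℕ} .{{_ : NonZero p}} {n : ℕ} where

  IsSaturated : ℕ → Pred (𝔽^ p n) 0ℓ
  IsSaturated m J =
    IsOrderIdeal m (supp J) ×
    (∀ i j → j ∈ supp J → _≺_ m i j → toℕ (lookup J i) ≡ p ∸ 1)

  _⊑_ : 𝔽^ p n → 𝔽^ p n → Set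
  J ⊑ J′ = ∀ i → toℕ (lookup J i) ≤ toℕ (lookup J′ i)

  -- Ideals m I is the set I(𝔾ℙ) for 𝔾ℙ = 𝔾ℍ(m,n).
  Ideals : ℕ → 𝔽^ p n → Pred (𝔽^ p n) 0ℓ
  Ideals m I J = IsSaturated m J × J ⊑ I

  isSaturated? : ∀ m → Decidable (IsSaturated m)
  isSaturated? m J =
    all? (λ i → all? λ j →
      _≼?_ m i j →-dec ((j ∈? supp J) →-dec (i ∈? supp J)))
    ×-dec
    all? (λ i → all? λ j →
      (j ∈? supp J) →-dec (_≺?_ m i j →-dec (toℕ (lookup J i) ℕ.≟ p ∸ 1)))

  ideals? : ∀ m I → Decidable (Ideals m I)
  ideals? m I J =
    isSaturated? m J ×-dec all? (λ i → toℕ (lookup J i) ℕ.≤? toℕ (lookup I i))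

  -- The vector (a, …, a, b, 0, …, 0) with m entries equal to a.
  stair : ℕ → Fin p → Fin p → 𝔽^ p n
  stair m a b = tabulate entry
    where
    entry : Fin n → Fin p
    entry i with <-cmp (toℕ i) m
    ... | tri< _ _ _ = a
    ... | tri≈ _ _ _ = b
    ... | tri> _ _ _ = 0ₚ

  -- Each element of [m] has multiplicity p - 1 and m + 1 has multiplicity t.
  idealI : ℕ → ℕ → 𝔽^ p n
  idealI m t = stair m ((p ∸ 1) mod p) (t mod p)

  -- (𝔽ₚᵐ × 0) ∪ {(-1, …, -1, j, 0, …, 0) : 1 ≤ j ≤ t}
  ExplicitIdeals : ℕ → ℕ → Pred (𝔽^ p n) 0ℓ
  ExplicitIdeals m t x =
    (∀ i → m ≤ toℕ i → lookup x i ≡ 0ₚ) ⊎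
    (∃ λ j → 1 ≤ j × j ≤ t × x ≡ stair m (-ₚ 1ₚ) (j mod p))

------------------------------------------------------------------------
-- The weight table.  For p ≥ 2, m < n and t < p no truncated subtraction below
-- has a negative true value.

minDist : (p m n t : ℕ) → ℕ
minDist p m n t = (p ∸ 1) * (p ^ (n ∸ 1) ∸ p ^ (m ∸ 1)) ∸ t

weightTable : (p m n t : ℕ) → List (ℕ × ℕ)
weightTable p m n t =
  (d                                           , (p ∸ 1) * c * ((p ∸ t + 1) * p ^ (m ∸ 1) ∸ 1)) List.∷
  (d + 1                                       , (p ∸ 1) * c * t * p ^ (m ∸ 1)) List.∷
  ((p ∸ 1) * (p ^ (n ∸ 1) ∸ p ^ (m ∸ 1))       , (p ^ (m ∸ 1) ∸ 1) * c) List.∷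
  ((p ∸ 1) * p ^ (n ∸ 1) ∸ t                   , (p ∸ 1) * c) List.∷
  ((p ∸ 1) * p ^ (n ∸ 1)                       , c ∸ 1) List.∷
  List.[]
  where
  d c : ℕ
  d = minDist p m n t
  c = p ^ (n ∸ m ∸ 1)

{-# OPTIONS --safe #-}
module Submission where

-- Write u = (u′ , a , u″) along 𝔽ₚⁿ = 𝔽ₚᵐ × 𝔽ₚ × 𝔽ₚʳ, where n = m + 1 + r, and put
-- q = p^(m-1), c = p^r, e = (p-1) q and T = (p-1) p^(n-1).  The complement of D
-- consists of 𝔽ₚᵐ × 0 and of the t vectors (-1, …, -1, j, 0, …, 0); see
-- ideal⇒explicit, explicit⇒ideal and idealList.  For u ≠ 0 the weight of the
-- codeword of u is the number of x in 𝔽ₚⁿ with u · x ≠ 0, which is T, minus the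
-- number of those in the complement of D.  As a hyperplane has a p-th of all
-- vectors, the latter is e (if u′ ≠ 0) or 0 (if u′ = 0), plus t - ν, where ν counts
-- the j in {1, …, t} with a j = s and s is the sum of the entries of u′.  With
-- d = T - e - t the weight is d + ν if u′ ≠ 0, and d + e + ν if u′ = 0
-- (W-nonzero, W-zero).
--
-- If a ≠ 0, then ν is 0 or 1, and it is 0 if moreover u′ = 0.  If a = 0, then ν is t or 0
-- according to whether s = 0.  So the weights are d, d + 1, d + t, d + e and
-- d + e + t, which are the weights of the table (weightTable≡rows).  The
-- frequencies are sums of indicators over u′, a and u″.  All but the first are
-- products or, for d + 1, sums over the steps j of sizes of affine hyperplanes
-- (size₂ to size₅); the first three together count the u with u′ ≠ 0, which
-- yields the first (size₁).  As nonzero u have words of positive weight, u is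
-- determined by its codeword, so counting vectors is counting codewords, and the
-- dimension is n.
--
-- The terms of the Griesmer bound are d itself and, for i ≥ 1, the numbers
-- (p-1) (p^(n-1-i) - p^(m-1-i)) for i < m and (p-1) p^(n-1-i) for i ≥ m; their sum
-- telescopes (term-step, griesmer-sum).
--
-- If r ≥ 1, the ratio of the smallest to the largest weight exceeds (p-1) / p, and
-- the code is minimal by the Ashikhmin-Barg criterion (ashikhminBarg).  If r = 0,
-- the last unit vector has a codeword of full support (not-minimal).

open import Defs
open import Level using (0ℓ)
open import Algebra.Bundles using (CommutativeRing)
import Algebra.Consequences.Propositional as Consequences
import Algebra.Properties.CommutativeSemigroup as CommutativeSemigroupProperties
import Algebra.Properties.Group as GroupProperties
import Algebra.Properties.Ring as RingProperties
open import Data.Bool.Base using (true; false; if_then_else_)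
open import Data.Nat.Base
  using (nonTrivial⇒n>1; ≢-nonZero; ℕ; zero; suc; _+_; _*_; _∸_; _^_; _/_; _%_; _≤_;
    _<_; z≤n; s≤s; NonZero; >-nonZero; >-nonZero⁻¹)
import Data.Nat.Properties as ℕ
open import Data.Nat.DivMod
  using (_mod_; n/1≡n; m%n<n; m<n⇒m%n≡m; n%n≡0; [m+kn]%n≡m%n; %-distribˡ-+;
    %-distribˡ-*; m<n⇒m/n≡0; m*n/n≡m; +-distrib-/-∣ʳ)
open import Data.Nat.Divisibility.Core using (_∣_; divides)
open import Data.Nat.Primality using (Prime; prime⇒nonTrivial)
open import Data.Nat.Coprimality using (coprime-Bézout; prime⇒coprime)
open import Data.Nat.GCD using (module Bézout)
open import Data.Nat.ListAction using (sum)
open import Data.Nat.ListAction.Properties using (sum-++; sum-↭)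
open import Data.Nat.Tactic.RingSolver using (solve-∀)
open import Data.Fin.Base as Fin using (Fin; toℕ; zero; suc)
import Data.Fin.Properties as Fin
open import Data.Fin.Subset using (_⊆_) renaming (_∈_ to _∈ₛ_)
open import Data.Fin.Subset.Properties using (drop-∷-⊆)
open import Data.List.Base as List
  using (List; []; _∷_; length; map; filter; allFin; upTo; applyUpTo; cartesianProduct;
    cartesianProductWith)
import Data.List.Properties as List
open import Data.List.Membership.Propositional using (_∈_)
open import Data.List.Membership.Propositional.Properties
  using (∈-map⁺; ∈-map⁻; ∈-++⁺ˡ; ∈-++⁺ʳ; ∈-++⁻; ∈-filter⁺; ∈-filter⁻; ∈-allFin;
    ∈-tabulate⁺; ∈-tabulate⁻; ∈-cartesianProductWith⁺)
open import Data.List.Relation.Binary.BagAndSetEquality using (∼bag⇒↭)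
open import Data.List.Membership.Propositional.Properties.WithK using (unique∧set⇒bag)
open import Data.List.Relation.Binary.Permutation.Propositional using (_↭_)
import Data.List.Relation.Binary.Permutation.Propositional.Properties as Perm
open import Data.List.Relation.Unary.All as All using (All; []; _∷_)
open import Data.List.Relation.Unary.AllPairs as AllPairs using ([]; _∷_)
open import Data.List.Relation.Unary.Any as Any using (Any; here; there)
open import Data.List.Relation.Unary.Linked using (Linked; []; [-]; _∷_)
open import Data.List.Relation.Unary.Linked.Properties using (Linked⇒AllPairs)
open import Data.List.Relation.Unary.Unique.Propositional using (Unique)
import Data.List.Relation.Unary.Unique.Propositional.Properties as Unique
open import Data.Product.Base using (∃; _×_; _,_; proj₁; proj₂)
open import Data.Sum.Base using (_⊎_; inj₁; inj₂)
open import Data.Vec.Base as Vec using (Vec; []; _∷_; _++_; lookup; replicate; tabulate)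
import Data.Vec.Properties as Vec
open import Function.Base using (_∘_; id)
open import Function.Bundles using (_⇔_; mk⇔; Equivalence)
open import Relation.Binary.Definitions using (tri<; tri≈; tri>)
open import Relation.Binary.PropositionalEquality
  using (_≡_; _≢_; refl; sym; trans; cong; cong₂; subst; isEquivalence; module
    ≡-Reasoning)
open import Relation.Nullary.Decidable using (Dec; yes; no; does; ¬?; _×-dec_)
open import Relation.Nullary.Negation.Core using (¬_; contradiction)
open import Relation.Unary using (Pred; Decidable)
open import Relation.Unary.Properties using (∁?)

-- Finite sums and counting

-- The sum of the values of f over a list.
∑ : {A : Set} → List A → (A → ℕ) → ℕ
∑ xs f = sum (map f xs)

-- The indicator of a decided proposition; sums of indicators count.
⟦_⟧ : {P : Set} → Dec P → ℕ
⟦ P? ⟧ = if does P? then 1 else 0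

⟦⟧-yes : {P : Set} (P? : Dec P) → P → ⟦ P? ⟧ ≡ 1
⟦⟧-yes (yes _) _ = refl
⟦⟧-yes (no ¬p) p = contradiction p ¬p

⟦⟧-no : {P : Set} (P? : Dec P) → ¬ P → ⟦ P? ⟧ ≡ 0
⟦⟧-no (yes p) ¬p = contradiction p ¬p
⟦⟧-no (no _)  _  = refl

⟦⟧-complement : {P : Set} (P? : Dec P) → ⟦ ¬? P? ⟧ + ⟦ P? ⟧ ≡ 1
⟦⟧-complement (yes _) = refl
⟦⟧-complement (no _)  = refl

⟦⟧-cong : {P Q : Set} (P? : Dec P) (Q? : Dec Q) → (P → Q) → (Q → P) → ⟦ P? ⟧ ≡ ⟦ Q? ⟧
⟦⟧-cong (yes p) Q? f g = sym (⟦⟧-yes Q? (f p))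
⟦⟧-cong (no ¬p) Q? f g = sym (⟦⟧-no Q? (¬p ∘ g))

private variable
  A B Z : Set

∑-cong : ∀ (xs : List A) {f g : A → ℕ} → (∀ x → f x ≡ g x) → ∑ xs f ≡ ∑ xs g
∑-cong xs f≗g = cong sum (List.map-cong f≗g xs)

∑-cong-∈ : ∀ (xs : List A) {f g : A → ℕ} → (∀ x → x ∈ xs → f x ≡ g x) → ∑ xs f ≡ ∑ xs g
∑-cong-∈ []       _   = refl
∑-cong-∈ (x ∷ xs) f≗g = cong₂ _+_ (f≗g x (here refl)) (∑-cong-∈ xs (λ y → f≗g y ∘ there))

∑-++ : ∀ (xs ys : List A) f → ∑ (xs List.++ ys) f ≡ ∑ xs f + ∑ ys f
∑-++ xs ys f = trans (cong sum (List.map-++ f xs ys)) (sum-++ (map f xs) (map f ys))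

∑-map : ∀ (h : B → A) xs f → ∑ (map h xs) f ≡ ∑ xs (f ∘ h)
∑-map h xs f = cong sum (sym (List.map-∘ xs))

∑-↭ : ∀ {xs ys : List A} f → xs ↭ ys → ∑ xs f ≡ ∑ ys f
∑-↭ f xs↭ys = sum-↭ (Perm.map⁺ f xs↭ys)

∑-+ : ∀ (xs : List A) f g → ∑ xs (λ x → f x + g x) ≡ ∑ xs f + ∑ xs g
∑-+ []       f g = refl
∑-+ (x ∷ xs) f g rewrite ∑-+ xs f g = rearrange (f x) (g x) (∑ xs f) (∑ xs g)
  where
  rearrange : ∀ a b c d → a + b + (c + d) ≡ a + c + (b + d)
  rearrange = solve-∀

∑-*ˡ : ∀ (xs : List A) k f → ∑ xs (λ x → k * f x) ≡ k * ∑ xs f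
∑-*ˡ []       k f = sym (ℕ.*-zeroʳ k)
∑-*ˡ (x ∷ xs) k f rewrite ∑-*ˡ xs k f = sym (ℕ.*-distribˡ-+ k (f x) (∑ xs f))

∑-*ʳ : ∀ (xs : List A) f k → ∑ xs (λ x → f x * k) ≡ ∑ xs f * k
∑-*ʳ []       f k = refl
∑-*ʳ (x ∷ xs) f k rewrite ∑-*ʳ xs f k = sym (ℕ.*-distribʳ-+ k (f x) (∑ xs f))

∑-const : ∀ (xs : List A) k → ∑ xs (λ _ → k) ≡ length xs * k
∑-const []       k = refl
∑-const (x ∷ xs) k = cong (k +_) (∑-const xs k)

∑-≤ : ∀ (xs : List A) {f g : A → ℕ} → (∀ x → f x ≤ g x) → ∑ xs f ≤ ∑ xs g
∑-≤ []       _   = z≤n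
∑-≤ (x ∷ xs) f≤g = ℕ.+-mono-≤ (f≤g x) (∑-≤ xs f≤g)

∑-swap : ∀ (xs : List A) (ys : List B) (f : A → B → ℕ) →
  ∑ xs (λ x → ∑ ys (f x)) ≡ ∑ ys (λ y → ∑ xs (λ x → f x y))
∑-swap []       ys f = sym (trans (∑-const ys 0) (ℕ.*-zeroʳ (length ys)))
∑-swap (x ∷ xs) ys f = trans (cong (∑ ys (f x) +_) (∑-swap xs ys f))
                             (sym (∑-+ ys (f x) (λ y → ∑ xs (λ x′ → f x′ y))))

∑-cartesianProductWith : ∀ (h : A → B → Z) xs ys f →
  ∑ (cartesianProductWith h xs ys) f ≡ ∑ xs (λ x → ∑ ys (λ y → f (h x y)))
∑-cartesianProductWith h []       ys f = refl
∑-cartesianProductWith h (x ∷ xs) ys f =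
  trans (∑-++ (map (h x) ys) (cartesianProductWith h xs ys) f)
        (cong₂ _+_ (∑-map (h x) ys f) (∑-cartesianProductWith h xs ys f))

length-filter≡∑ : ∀ {P : Pred A 0ℓ} (P? : Decidable P) xs →
  length (filter P? xs) ≡ ∑ xs (λ x → ⟦ P? x ⟧)
length-filter≡∑ P? []       = refl
length-filter≡∑ P? (x ∷ xs) with does (P? x)
... | true  = cong suc (length-filter≡∑ P? xs)
... | false = length-filter≡∑ P? xs

∑-none : ∀ xs {P : Pred A 0ℓ} (P? : Decidable P) → (∀ {x} → x ∈ xs → ¬ P x) →
  ∑ xs (λ x → ⟦ P? x ⟧) ≡ 0
∑-none xs P? none =
  trans (∑-cong-∈ xs (λ x x∈xs → ⟦⟧-no (P? x) (none x∈xs)))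
        (trans (∑-const xs 0) (ℕ.*-zeroʳ (length xs)))

∑-unique : ∀ {P : Pred A 0ℓ} (P? : Decidable P) {xs} → Unique xs →
  (∀ {x y} → P x → P y → x ≡ y) → ∀ {x} → x ∈ xs → P x → ∑ xs (λ x → ⟦ P? x ⟧) ≡ 1
∑-unique P? (x∉xs ∷ _) unique (here refl) Px =
  cong₂ _+_ (⟦⟧-yes (P? _) Px)
            (∑-none _ P? (λ y∈xs Py → All.lookup x∉xs y∈xs (unique Px Py)))
∑-unique P? (y∉xs ∷ u) unique (there x∈xs) Px =
  cong₂ _+_ (⟦⟧-no (P? _) (λ Py → All.lookup y∉xs x∈xs (unique Py Px)))
            (∑-unique P? u unique x∈xs Px)

∑-atMostOne : ∀ {P : Pred A 0ℓ} (P? : Decidable P) {xs} → Unique xs →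
  (∀ {x y} → P x → P y → x ≡ y) →
  ∑ xs (λ x → ⟦ P? x ⟧) ≡ 0 ⊎ ∑ xs (λ x → ⟦ P? x ⟧) ≡ 1
∑-atMostOne P? {[]}     []          unique = inj₁ refl
∑-atMostOne P? {x ∷ xs} (x∉xs ∷ u) unique with P? x
... | yes Px = inj₂ (cong suc (∑-none _ P? (λ y∈xs Py → All.lookup x∉xs y∈xs (unique Px Py))))
... | no _   = ∑-atMostOne P? u unique

∑-complement : ∀ (xs : List A) {P : Pred A 0ℓ} (P? : Decidable P) →
  ∑ xs (λ x → ⟦ ¬? (P? x) ⟧) + ∑ xs (λ x → ⟦ P? x ⟧) ≡ length xs
∑-complement xs P? =
  trans (sym (∑-+ xs _ _))
        (trans (∑-cong xs (λ x → ⟦⟧-complement (P? x)))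
               (trans (∑-const xs 1) (ℕ.*-identityʳ (length xs))))

-- The field 𝔽ₚ

-- Reduction modulo p is a surjective homomorphism from ℕ, so the laws of 𝔽ₚ
-- follow from those of ℕ.
module _ {p : ℕ} .{{_ : NonZero p}} where

  toℕ-mod : ∀ a → toℕ (a mod p) ≡ a % p
  toℕ-mod a = Fin.toℕ-fromℕ< (m%n<n a p)

  mod-cong : ∀ {a b} → a % p ≡ b % p → a mod p ≡ b mod p
  mod-cong {a} {b} eq = Fin.toℕ-injective (trans (toℕ-mod a) (trans eq (sym (toℕ-mod b))))

  mod-toℕ : ∀ (x : Fin p) → toℕ x mod p ≡ x
  mod-toℕ x = Fin.toℕ-injective (trans (toℕ-mod (toℕ x)) (m<n⇒m%n≡m (Fin.toℕ<n x)))

  mod-+ : ∀ a b → (a mod p) +ₚ (b mod p) ≡ (a + b) mod p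
  mod-+ a b rewrite toℕ-mod a | toℕ-mod b = mod-cong (sym (%-distribˡ-+ a b p))

  mod-* : ∀ a b → (a mod p) *ₚ (b mod p) ≡ (a * b) mod p
  mod-* a b rewrite toℕ-mod a | toℕ-mod b = mod-cong (sym (%-distribˡ-* a b p))

  private
    lift₁ : (P : Fin p → Set) → (∀ a → P (a mod p)) → ∀ x → P x
    lift₁ P h x = subst P (mod-toℕ x) (h (toℕ x))

  +ₚ-comm : ∀ x y → x +ₚ y ≡ y +ₚ x
  +ₚ-comm x y = cong (_mod p) (ℕ.+-comm (toℕ x) (toℕ y))

  *ₚ-comm : ∀ x y → x *ₚ y ≡ y *ₚ x
  *ₚ-comm x y = cong (_mod p) (ℕ.*-comm (toℕ x) (toℕ y))

  +ₚ-assoc : ∀ x y z → (x +ₚ y) +ₚ z ≡ x +ₚ (y +ₚ z)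
  +ₚ-assoc = lift₁ _ λ a → lift₁ _ λ b → lift₁ _ λ c → on a b c
    where
    on : ∀ a b c → ((a mod p) +ₚ (b mod p)) +ₚ (c mod p) ≡ (a mod p) +ₚ ((b mod p) +ₚ (c mod p))
    on a b c rewrite mod-+ a b | mod-+ (a + b) c | mod-+ b c | mod-+ a (b + c) =
      cong (_mod p) (ℕ.+-assoc a b c)

  *ₚ-assoc : ∀ x y z → (x *ₚ y) *ₚ z ≡ x *ₚ (y *ₚ z)
  *ₚ-assoc = lift₁ _ λ a → lift₁ _ λ b → lift₁ _ λ c → on a b c
    where
    on : ∀ a b c → ((a mod p) *ₚ (b mod p)) *ₚ (c mod p) ≡ (a mod p) *ₚ ((b mod p) *ₚ (c mod p))
    on a b c rewrite mod-* a b | mod-* (a * b) c | mod-* b c | mod-* a (b * c) =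
      cong (_mod p) (ℕ.*-assoc a b c)

  *ₚ-distribˡ-+ₚ : ∀ x y z → x *ₚ (y +ₚ z) ≡ x *ₚ y +ₚ x *ₚ z
  *ₚ-distribˡ-+ₚ = lift₁ _ λ a → lift₁ _ λ b → lift₁ _ λ c → on a b c
    where
    on : ∀ a b c → (a mod p) *ₚ ((b mod p) +ₚ (c mod p)) ≡
                   (a mod p) *ₚ (b mod p) +ₚ (a mod p) *ₚ (c mod p)
    on a b c rewrite mod-+ b c | mod-* a (b + c) | mod-* a b | mod-* a c | mod-+ (a * b) (a * c) =
      cong (_mod p) (ℕ.*-distribˡ-+ a b c)

  +ₚ-identityˡ : ∀ x → 0ₚ +ₚ x ≡ x
  +ₚ-identityˡ = lift₁ _ (mod-+ 0)

  *ₚ-identityˡ : ∀ x → 1ₚ *ₚ x ≡ x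
  *ₚ-identityˡ = lift₁ _ λ a → trans (mod-* 1 a) (cong (_mod p) (ℕ.*-identityˡ a))

  -ₚ-inverseʳ : ∀ x → x +ₚ (-ₚ x) ≡ 0ₚ
  -ₚ-inverseʳ x = begin
    x +ₚ (-ₚ x)                         ≡⟨ cong (_+ₚ (-ₚ x)) (mod-toℕ x) ⟨
    (toℕ x mod p) +ₚ (-ₚ x)             ≡⟨ mod-+ (toℕ x) (p ∸ toℕ x) ⟩
    (toℕ x + (p ∸ toℕ x)) mod p         ≡⟨ cong (_mod p) (ℕ.m+[n∸m]≡n (ℕ.<⇒≤ (Fin.toℕ<n x))) ⟩
    p mod p                             ≡⟨ mod-cong {p} {0} (trans (n%n≡0 p) (sym (m<n⇒m%n≡m (>-nonZero⁻¹ p)))) ⟩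
    0ₚ                                  ∎
    where open ≡-Reasoning

𝔽-ring : (p : ℕ) .{{_ : NonZero p}} → CommutativeRing 0ℓ 0ℓ
𝔽-ring p = record
  { Carrier = Fin p ; _≈_ = _≡_ ; _+_ = _+ₚ_ ; _*_ = _*ₚ_ ; -_ = -ₚ_ ; 0# = 0ₚ ; 1# = 1ₚ
  ; isCommutativeRing = record
    { isRing = record
      { +-isAbelianGroup = record
        { isGroup = record
          { isMonoid = record
            { isSemigroup = record
              { isMagma = record { isEquivalence = isEquivalence ; ∙-cong = cong₂ _+ₚ_ }
              ; assoc = +ₚ-assoc }
            ; identity = Consequences.comm∧idˡ⇒id +ₚ-comm +ₚ-identityˡ }
          ; inverse = Consequences.comm∧invʳ⇒inv +ₚ-comm -ₚ-inverseʳ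
          ; ⁻¹-cong = cong -ₚ_ }
        ; comm = +ₚ-comm }
      ; *-cong = cong₂ _*ₚ_
      ; *-assoc = *ₚ-assoc
      ; *-identity = Consequences.comm∧idˡ⇒id *ₚ-comm *ₚ-identityˡ
      ; distrib = Consequences.comm∧distrˡ⇒distr (cong₂ _+ₚ_) *ₚ-comm *ₚ-distribˡ-+ₚ }
    ; *-comm = *ₚ-comm } }

module _ {p : ℕ} .{{_ : NonZero p}} where

  open CommutativeRing (𝔽-ring p) using (ring; zeroʳ; +-group)
  open RingProperties ring using (-‿distribʳ-*)

  -- The inverse comes from the Bézout identity for p and the representative of x.
  *ₚ-inverse : Prime p → ∀ x → x ≢ 0ₚ → ∃ λ y → x *ₚ y ≡ 1ₚ
  *ₚ-inverse p-prime x x≢0 = from (coprime-Bézout (prime⇒coprime p-prime {{a≢0}} (Fin.toℕ<n x)))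
    where
    open ≡-Reasoning
    a : ℕ
    a = toℕ x
    a≢0 : NonZero a
    a≢0 = ≢-nonZero λ a≡0 → x≢0 (trans (sym (mod-toℕ x)) (cong (_mod p) a≡0))
    times : ∀ j → x *ₚ (j mod p) ≡ (a * j) mod p
    times j = trans (cong (_*ₚ (j mod p)) (sym (mod-toℕ x))) (mod-* a j)
    from : Bézout.Identity 1 p a → ∃ λ y → x *ₚ y ≡ 1ₚ
    from (Bézout.-+ i j 1+ip≡ja) = j mod p , (begin
      x *ₚ (j mod p)     ≡⟨ times j ⟩
      (a * j) mod p      ≡⟨ cong (_mod p) (trans (ℕ.*-comm a j) (sym 1+ip≡ja)) ⟩
      (1 + i * p) mod p  ≡⟨ mod-cong {p} {1 + i * p} {1} ([m+kn]%n≡m%n 1 i p) ⟩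
      1ₚ                 ∎)
    from (Bézout.+- i j 1+ja≡ip) = -ₚ (j mod p) , (begin
      x *ₚ (-ₚ (j mod p))  ≡⟨ -‿distribʳ-* x (j mod p) ⟨
      -ₚ (x *ₚ (j mod p))  ≡⟨ inverseˡ-unique 1ₚ (x *ₚ (j mod p)) 1+xj≡0 ⟨
      1ₚ                   ∎)
      where
      open GroupProperties +-group using (inverseˡ-unique)
      1+xj≡0 : 1ₚ +ₚ x *ₚ (j mod p) ≡ 0ₚ
      1+xj≡0 = begin
        1ₚ +ₚ x *ₚ (j mod p)      ≡⟨ cong (1ₚ +ₚ_) (times j) ⟩
        1ₚ +ₚ ((a * j) mod p)     ≡⟨ mod-+ 1 (a * j) ⟩
        (1 + a * j) mod p         ≡⟨ cong (_mod p) (trans (cong suc (ℕ.*-comm a j)) 1+ja≡ip) ⟩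
        (i * p) mod p             ≡⟨ mod-cong {p} {i * p} {0} ([m+kn]%n≡m%n 0 i p) ⟩
        0ₚ                        ∎

  open CommutativeRing (𝔽-ring p) using (+-identityʳ; *-identityʳ; zeroˡ; distribʳ; distribˡ; -‿inverseʳ)
  open RingProperties ring using (-1*x≈-x; -‿distribˡ-*)
  open GroupProperties +-group using (x∙y⁻¹≈ε⇒x≈y; x≈y⇒x∙y⁻¹≈ε; ∙-cancelˡ)

  *ₚ-cancelʳ : Prime p → ∀ {x} → x ≢ 0ₚ → ∀ {y z} → y *ₚ x ≡ z *ₚ x → y ≡ z
  *ₚ-cancelʳ p-prime {x} x≢0 {y} {z} yx≡zx with w , xw≡1 ← *ₚ-inverse p-prime x x≢0 = begin
    y               ≡⟨ *-identityʳ y ⟨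
    y *ₚ 1ₚ         ≡⟨ cong (y *ₚ_) xw≡1 ⟨
    y *ₚ (x *ₚ w)   ≡⟨ *ₚ-assoc y x w ⟨
    (y *ₚ x) *ₚ w   ≡⟨ cong (_*ₚ w) yx≡zx ⟩
    (z *ₚ x) *ₚ w   ≡⟨ *ₚ-assoc z x w ⟩
    z *ₚ (x *ₚ w)   ≡⟨ cong (z *ₚ_) xw≡1 ⟩
    z *ₚ 1ₚ         ≡⟨ *-identityʳ z ⟩
    z               ∎
    where open ≡-Reasoning

  -- The element a solves b + a x = 0.  For x ≠ 0 there is exactly one such a.
  IsAffineRoot : Fin p → Fin p → Pred (Fin p) 0ℓ
  IsAffineRoot b x a = b +ₚ a *ₚ x ≡ 0ₚ

  affineRoot-unique : Prime p → ∀ {b x} → x ≢ 0ₚ → ∀ {a a′} →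
    IsAffineRoot b x a → IsAffineRoot b x a′ → a ≡ a′
  affineRoot-unique p-prime {b} {x} x≢0 {a} {a′} eq eq′ =
    *ₚ-cancelʳ p-prime x≢0 (∙-cancelˡ b (a *ₚ x) (a′ *ₚ x) (trans eq (sym eq′)))

  affineRoot-exists : Prime p → ∀ b {x} → x ≢ 0ₚ → ∃ (IsAffineRoot b x)
  affineRoot-exists p-prime b {x} x≢0 with y , xy≡1 ← *ₚ-inverse p-prime x x≢0 =
    (-ₚ b) *ₚ y , (begin
    b +ₚ (-ₚ b) *ₚ y *ₚ x     ≡⟨ cong (b +ₚ_) (*ₚ-assoc (-ₚ b) y x) ⟩
    b +ₚ (-ₚ b) *ₚ (y *ₚ x)   ≡⟨ cong (λ z → b +ₚ (-ₚ b) *ₚ z) (trans (*ₚ-comm y x) xy≡1) ⟩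
    b +ₚ (-ₚ b) *ₚ 1ₚ         ≡⟨ cong (b +ₚ_) (*-identityʳ (-ₚ b)) ⟩
    b +ₚ (-ₚ b)               ≡⟨ -‿inverseʳ b ⟩
    0ₚ                        ∎)
    where open ≡-Reasoning

  affineRoots : Prime p → ∀ b {x} → x ≢ 0ₚ →
    ∑ (allFin p) (λ a → ⟦ b +ₚ a *ₚ x Fin.≟ 0ₚ ⟧) ≡ 1
  affineRoots p-prime b x≢0 with a , root ← affineRoot-exists p-prime b x≢0 =
    ∑-unique (λ a → b +ₚ a *ₚ _ Fin.≟ 0ₚ) (Unique.allFin⁺ p) (affineRoot-unique p-prime x≢0) (∈-allFin a) root

  affineNonRoots : Prime p → ∀ b {x} → x ≢ 0ₚ →
    ∑ (allFin p) (λ a → ⟦ ¬? (b +ₚ a *ₚ x Fin.≟ 0ₚ) ⟧) ≡ p ∸ 1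
  affineNonRoots p-prime b {x} x≢0 = ℕ.+-cancelʳ-≡ 1 _ _ (begin
    ∑ (allFin p) (λ a → ⟦ ¬? (R a) ⟧) + 1
      ≡⟨ cong (∑ (allFin p) (λ a → ⟦ ¬? (R a) ⟧) +_) (affineRoots p-prime b x≢0) ⟨
    ∑ (allFin p) (λ a → ⟦ ¬? (R a) ⟧) + ∑ (allFin p) (λ a → ⟦ R a ⟧)
      ≡⟨ ∑-complement (allFin p) R ⟩
    length (allFin p)   ≡⟨ List.length-tabulate id ⟩
    p                   ≡⟨ ℕ.m∸n+n≡m (>-nonZero⁻¹ p) ⟨
    p ∸ 1 + 1           ∎)
    where
    open ≡-Reasoning
    R : ∀ a → Dec (b +ₚ a *ₚ x ≡ 0ₚ)
    R a = b +ₚ a *ₚ x Fin.≟ 0ₚ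

-- Vectors over 𝔽ₚ

  infix 4 _≟ᵥ_
  _≟ᵥ_ : ∀ {n} (u v : 𝔽^ p n) → Dec (u ≡ v)
  _≟ᵥ_ = Vec.≡-dec Fin._≟_

  ·-comm : ∀ {n} (u x : 𝔽^ p n) → u · x ≡ x · u
  ·-comm []      []      = refl
  ·-comm (a ∷ u) (b ∷ x) = cong₂ _+ₚ_ (*ₚ-comm a b) (·-comm u x)

  ·-zeroˡ : ∀ {n} (x : 𝔽^ p n) → 0ᵥ · x ≡ 0ₚ
  ·-zeroˡ []      = refl
  ·-zeroˡ (b ∷ x) = trans (cong₂ _+ₚ_ (zeroˡ b) (·-zeroˡ x)) (+ₚ-identityˡ 0ₚ)

  ·-zeroʳ : ∀ {n} (x : 𝔽^ p n) → x · 0ᵥ ≡ 0ₚ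
  ·-zeroʳ x = trans (·-comm x 0ᵥ) (·-zeroˡ x)

  ·-++ : ∀ {m n} (u x : 𝔽^ p m) (v y : 𝔽^ p n) → (u ++ v) · (x ++ y) ≡ u · x +ₚ v · y
  ·-++ []      []      v y = sym (+ₚ-identityˡ (v · y))
  ·-++ (a ∷ u) (b ∷ x) v y =
    trans (cong (a *ₚ b +ₚ_) (·-++ u x v y)) (sym (+ₚ-assoc (a *ₚ b) (u · x) (v · y)))

  ·-distribʳ-⊕ : ∀ {n} (x u v : 𝔽^ p n) → (u ⊕ v) · x ≡ u · x +ₚ v · x
  ·-distribʳ-⊕ []      []      []      = sym (+ₚ-identityˡ 0ₚ)
  ·-distribʳ-⊕ (b ∷ x) (a ∷ u) (c ∷ v) = begin
    (a +ₚ c) *ₚ b +ₚ (u ⊕ v) · x            ≡⟨ cong₂ _+ₚ_ (distribʳ b a c) (·-distribʳ-⊕ x u v) ⟩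
    (a *ₚ b +ₚ c *ₚ b) +ₚ (u · x +ₚ v · x)  ≡⟨ +-interchange (a *ₚ b) (c *ₚ b) (u · x) (v · x) ⟩
    (a *ₚ b +ₚ u · x) +ₚ (c *ₚ b +ₚ v · x)  ∎
    where
    open ≡-Reasoning
    open CommutativeSemigroupProperties (CommutativeRing.+-commutativeSemigroup (𝔽-ring p))
      renaming (interchange to +-interchange)

  ·-⊙ : ∀ {n} a (u x : 𝔽^ p n) → (a ⊙ u) · x ≡ a *ₚ (u · x)
  ·-⊙ a []      []      = sym (zeroʳ a)
  ·-⊙ a (c ∷ u) (b ∷ x) =
    trans (cong₂ _+ₚ_ (*ₚ-assoc a c b) (·-⊙ a u x)) (sym (distribˡ a (c *ₚ b) (u · x)))

  ⊕-identityˡ : ∀ {n} (v : 𝔽^ p n) → 0ᵥ ⊕ v ≡ v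
  ⊕-identityˡ []      = refl
  ⊕-identityˡ (x ∷ v) = cong₂ _∷_ (+ₚ-identityˡ x) (⊕-identityˡ v)

  ⊕-identityʳ : ∀ {n} (v : 𝔽^ p n) → v ⊕ 0ᵥ ≡ v
  ⊕-identityʳ []      = refl
  ⊕-identityʳ (x ∷ v) = cong₂ _∷_ (+-identityʳ x) (⊕-identityʳ v)

  ⊙-zeroˡ : ∀ {n} (v : 𝔽^ p n) → 0ₚ ⊙ v ≡ 0ᵥ
  ⊙-zeroˡ []      = refl
  ⊙-zeroˡ (x ∷ v) = cong₂ _∷_ (zeroˡ x) (⊙-zeroˡ v)

  ⊙-zeroʳ : ∀ {n} a → a ⊙ 0ᵥ {n = n} ≡ 0ᵥ
  ⊙-zeroʳ {zero}  a = refl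
  ⊙-zeroʳ {suc n} a = cong₂ _∷_ (zeroʳ a) (⊙-zeroʳ a)

  infixl 6 _⊖_
  _⊖_ : ∀ {n} → 𝔽^ p n → 𝔽^ p n → 𝔽^ p n
  v ⊖ w = v ⊕ (-ₚ 1ₚ) ⊙ w

  private
    difference : ∀ x y → x +ₚ (-ₚ 1ₚ) *ₚ y ≡ x +ₚ (-ₚ y)
    difference x y = cong (x +ₚ_) (-1*x≈-x y)

  x-y≡0⇒x≡y : ∀ x y → x +ₚ (-ₚ 1ₚ) *ₚ y ≡ 0ₚ → x ≡ y
  x-y≡0⇒x≡y x y eq = x∙y⁻¹≈ε⇒x≈y x y (trans (sym (difference x y)) eq)

  x≡y⇒x-y≡0 : ∀ {x y} → x ≡ y → x +ₚ (-ₚ 1ₚ) *ₚ y ≡ 0ₚ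
  x≡y⇒x-y≡0 {x} {y} eq = trans (difference x y) (x≈y⇒x∙y⁻¹≈ε eq)

  u⊖v≡0⇒u≡v : ∀ {n} (u v : 𝔽^ p n) → u ⊖ v ≡ 0ᵥ → u ≡ v
  u⊖v≡0⇒u≡v []      []      _  = refl
  u⊖v≡0⇒u≡v (x ∷ u) (y ∷ v) eq with eq₀ , eq₁ ← Vec.∷-injective eq =
    cong₂ _∷_ (x-y≡0⇒x≡y x y eq₀) (u⊖v≡0⇒u≡v u v eq₁)

  ⊖-identityʳ : ∀ {n} (v : 𝔽^ p n) → v ⊖ 0ᵥ ≡ v
  ⊖-identityʳ v = trans (cong (v ⊕_) (⊙-zeroʳ (-ₚ 1ₚ))) (⊕-identityʳ v)

  0ᵥ-++ : ∀ m {n} → 0ᵥ {n = m + n} ≡ 0ᵥ {n = m} ++ 0ᵥ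
  0ᵥ-++ zero    = refl
  0ᵥ-++ (suc m) = cong (0ₚ ∷_) (0ᵥ-++ m)

  -- The unit vectors, in order.
  units : ∀ n → Vec (𝔽^ p n) n
  units zero    = []
  units (suc n) = (1ₚ ∷ 0ᵥ) ∷ Vec.map (0ₚ ∷_) (units n)

  lincomb-map-0∷ : ∀ {k n} (a : 𝔽^ p k) (b : Vec (𝔽^ p n) k) →
    lincomb a (Vec.map (0ₚ ∷_) b) ≡ 0ₚ ∷ lincomb a b
  lincomb-map-0∷ []      []      = refl
  lincomb-map-0∷ (x ∷ a) (v ∷ b) rewrite lincomb-map-0∷ a b =
    cong (_∷ (x ⊙ v ⊕ lincomb a b)) (trans (+-identityʳ (x *ₚ 0ₚ)) (zeroʳ x))

  lincomb-units : ∀ {n} (a : 𝔽^ p n) → lincomb a (units n) ≡ a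
  lincomb-units []                = refl
  lincomb-units {suc n} (x ∷ a) rewrite lincomb-map-0∷ a (units n) | lincomb-units a =
    cong₂ _∷_ (trans (+-identityʳ (x *ₚ 1ₚ)) (*-identityʳ x))
              (trans (cong (_⊕ a) (⊙-zeroʳ x)) (⊕-identityˡ a))

-- Counting vectors

  allVectors-complete : ∀ {n} (v : 𝔽^ p n) → v ∈ allVectors p n
  allVectors-complete []      = here refl
  allVectors-complete (x ∷ v) = ∈-cartesianProductWith⁺ _∷_ (∈-allFin x) (allVectors-complete v)

  allVectors-unique : ∀ n → Unique (allVectors p n)
  allVectors-unique zero    = [] ∷ []
  allVectors-unique (suc n) =
    Unique.cartesianProductWith⁺ _∷_ Vec.∷-injective (Unique.allFin⁺ p) (allVectors-unique n)

  ∑-allFin-const : ∀ k → ∑ (allFin p) (λ _ → k) ≡ p * k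
  ∑-allFin-const k = trans (∑-const (allFin p) k) (cong (_* k) (List.length-tabulate {n = p} id))

  ∑-∷ : ∀ {n} (f : 𝔽^ p (suc n) → ℕ) →
    ∑ (allVectors p (suc n)) f ≡ ∑ (allFin p) (λ x → ∑ (allVectors p n) (λ v → f (x ∷ v)))
  ∑-∷ {n} = ∑-cartesianProductWith _∷_ (allFin p) (allVectors p n)

  ∑-split : ∀ m {n} (f : 𝔽^ p (m + n) → ℕ) →
    ∑ (allVectors p (m + n)) f ≡
    ∑ (allVectors p m) (λ v → ∑ (allVectors p n) (λ w → f (v ++ w)))
  ∑-split zero    f = sym (ℕ.+-identityʳ _)
  ∑-split (suc m) f = begin
    ∑ (allVectors p (suc m + _)) f
      ≡⟨ ∑-∷ f ⟩
    ∑ (allFin p) (λ x → ∑ (allVectors p (m + _)) (λ v → f (x ∷ v)))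
      ≡⟨ ∑-cong (allFin p) (λ x → ∑-split m (λ v → f (x ∷ v))) ⟩
    ∑ (allFin p) (λ x → ∑ (allVectors p m) (λ v → ∑ (allVectors p _) (λ w → f (x ∷ v ++ w))))
      ≡⟨ ∑-∷ (λ v → ∑ (allVectors p _) (λ w → f (v ++ w))) ⟨
    ∑ (allVectors p (suc m)) (λ v → ∑ (allVectors p _) (λ w → f (v ++ w)))
      ∎
    where open ≡-Reasoning

  length-allVectors : ∀ n → length (allVectors p n) ≡ p ^ n
  length-allVectors n = trans (sym (ℕ.*-identityʳ _)) (trans (sym (∑-const (allVectors p n) 1)) (count n))
    where
    count : ∀ n → ∑ (allVectors p n) (λ _ → 1) ≡ p ^ n
    count zero    = refl
    count (suc n) = trans (∑-∷ {n} (λ _ → 1)) (trans (∑-cong (allFin p) (λ _ → count n)) (∑-allFin-const (p ^ n)))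

  ∑-zero-vector : ∀ n → ∑ (allVectors p n) (λ v → ⟦ v ≟ᵥ 0ᵥ ⟧) ≡ 1
  ∑-zero-vector n = ∑-unique (_≟ᵥ 0ᵥ) (allVectors-unique n) (λ v≡0 w≡0 → trans v≡0 (sym w≡0))
                             (allVectors-complete 0ᵥ) refl

  ∑-nonzero-vectors : ∀ n → ∑ (allVectors p n) (λ v → ⟦ ¬? (v ≟ᵥ 0ᵥ) ⟧) + 1 ≡ p ^ n
  ∑-nonzero-vectors n =
    trans (cong (∑ (allVectors p n) (λ v → ⟦ ¬? (v ≟ᵥ 0ᵥ) ⟧) +_) (sym (∑-zero-vector n)))
          (trans (∑-complement (allVectors p n) (_≟ᵥ 0ᵥ)) (length-allVectors n))

  -- An affine hyperplane of 𝔽ₚⁿ⁺¹ has pⁿ points.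
  hyperplane : Prime p → ∀ {n} (u : 𝔽^ p (suc n)) → u ≢ 0ᵥ → ∀ b →
    ∑ (allVectors p (suc n)) (λ x → ⟦ b +ₚ u · x Fin.≟ 0ₚ ⟧) ≡ p ^ n
  hyperplane p-prime {n} (a ∷ u) au≢0 b = trans (∑-∷ _) (by-tail (u ≟ᵥ 0ᵥ))
    where
    open ≡-Reasoning
    by-tail : Dec (u ≡ 0ᵥ) →
      ∑ (allFin p) (λ x → ∑ (allVectors p n) (λ v → ⟦ b +ₚ (a *ₚ x +ₚ u · v) Fin.≟ 0ₚ ⟧)) ≡ p ^ n
    by-tail (yes u≡0) = begin
      ∑ (allFin p) (λ x → ∑ (allVectors p n) (λ v → ⟦ b +ₚ (a *ₚ x +ₚ u · v) Fin.≟ 0ₚ ⟧))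
        ≡⟨ ∑-cong (allFin p) (λ x → trans
             (∑-cong (allVectors p n) λ v → cong (λ y → ⟦ b +ₚ y Fin.≟ 0ₚ ⟧) (drop-tail x v))
             (trans (∑-const (allVectors p n) _) (cong (_* ⟦ b +ₚ x *ₚ a Fin.≟ 0ₚ ⟧) (length-allVectors n)))) ⟩
      ∑ (allFin p) (λ x → p ^ n * ⟦ b +ₚ x *ₚ a Fin.≟ 0ₚ ⟧)
        ≡⟨ ∑-*ˡ (allFin p) (p ^ n) _ ⟩
      p ^ n * ∑ (allFin p) (λ x → ⟦ b +ₚ x *ₚ a Fin.≟ 0ₚ ⟧)
        ≡⟨ cong (p ^ n *_) (affineRoots p-prime b (λ a≡0 → au≢0 (cong₂ _∷_ a≡0 u≡0))) ⟩
      p ^ n * 1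
        ≡⟨ ℕ.*-identityʳ (p ^ n) ⟩
      p ^ n
        ∎
      where
      drop-tail : ∀ x v → a *ₚ x +ₚ u · v ≡ x *ₚ a
      drop-tail x v = trans (cong₂ _+ₚ_ (*ₚ-comm a x) (trans (cong (_· v) u≡0) (·-zeroˡ v)))
                            (+-identityʳ (x *ₚ a))
    by-tail (no u≢0) = nonzero-tail u u≢0
      where
      nonzero-tail : ∀ {n} (u : 𝔽^ p n) → u ≢ 0ᵥ →
        ∑ (allFin p) (λ x → ∑ (allVectors p n) (λ v → ⟦ b +ₚ (a *ₚ x +ₚ u · v) Fin.≟ 0ₚ ⟧)) ≡ p ^ n
      nonzero-tail []                 u≢0 = contradiction refl u≢0
      nonzero-tail {suc k} u′@(_ ∷ _) u≢0 = begin
        ∑ (allFin p) (λ x → ∑ (allVectors p (suc k)) (λ v → ⟦ b +ₚ (a *ₚ x +ₚ u′ · v) Fin.≟ 0ₚ ⟧))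
          ≡⟨ ∑-cong (allFin p) (λ x → ∑-cong (allVectors p (suc k)) λ v →
               cong (λ y → ⟦ y Fin.≟ 0ₚ ⟧) (sym (+ₚ-assoc b (a *ₚ x) (u′ · v)))) ⟩
        ∑ (allFin p) (λ x → ∑ (allVectors p (suc k)) (λ v → ⟦ (b +ₚ a *ₚ x) +ₚ u′ · v Fin.≟ 0ₚ ⟧))
          ≡⟨ ∑-cong (allFin p) (λ x → hyperplane p-prime u′ u≢0 (b +ₚ a *ₚ x)) ⟩
        ∑ (allFin p) (λ _ → p ^ k)
          ≡⟨ ∑-allFin-const (p ^ k) ⟩
        p * p ^ k
          ∎

  hyperplane₀ : Prime p → ∀ {n} (u : 𝔽^ p (suc n)) → u ≢ 0ᵥ →
    ∑ (allVectors p (suc n)) (λ x → ⟦ u · x Fin.≟ 0ₚ ⟧) ≡ p ^ n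
  hyperplane₀ p-prime u u≢0 =
    trans (∑-cong (allVectors p _) (λ x → cong (λ y → ⟦ y Fin.≟ 0ₚ ⟧) (sym (+ₚ-identityˡ (u · x)))))
          (hyperplane p-prime u u≢0 0ₚ)

  hyperplane-complement : Prime p → ∀ {n} (u : 𝔽^ p (suc n)) → u ≢ 0ᵥ →
    ∑ (allVectors p (suc n)) (λ x → ⟦ ¬? (u · x Fin.≟ 0ₚ) ⟧) ≡ (p ∸ 1) * p ^ n
  hyperplane-complement p-prime {n} u u≢0 = ℕ.+-cancelʳ-≡ (p ^ n) _ _ (begin
    ∑ V (λ x → ⟦ ¬? (u · x Fin.≟ 0ₚ) ⟧) + p ^ n
      ≡⟨ cong (∑ V (λ x → ⟦ ¬? (u · x Fin.≟ 0ₚ) ⟧) +_) (hyperplane₀ p-prime u u≢0) ⟨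
    ∑ V (λ x → ⟦ ¬? (u · x Fin.≟ 0ₚ) ⟧) + ∑ V (λ x → ⟦ u · x Fin.≟ 0ₚ ⟧)
      ≡⟨ ∑-complement V (λ x → u · x Fin.≟ 0ₚ) ⟩
    length V                     ≡⟨ length-allVectors (suc n) ⟩
    p * p ^ n                    ≡⟨ cong (_* p ^ n) (ℕ.m∸n+n≡m (>-nonZero⁻¹ p)) ⟨
    (p ∸ 1 + 1) * p ^ n          ≡⟨ ℕ.*-distribʳ-+ (p ^ n) (p ∸ 1) 1 ⟩
    (p ∸ 1) * p ^ n + 1 * p ^ n  ≡⟨ cong ((p ∸ 1) * p ^ n +_) (ℕ.*-identityˡ (p ^ n)) ⟩
    (p ∸ 1) * p ^ n + p ^ n      ∎)
    where
    open ≡-Reasoning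
    V : List (𝔽^ p (suc n))
    V = allVectors p (suc n)

-- Weights and supports

  wt-∷ : ∀ {n} x (v : 𝔽^ p n) → wt (x ∷ v) ≡ ⟦ ¬? (x Fin.≟ 0ₚ) ⟧ + wt v
  wt-∷ x v with x Fin.≟ 0ₚ
  ... | yes _ = refl
  ... | no _  = refl

  wt-map : ∀ {A : Set} (f : A → Fin p) xs →
    wt (Vec.map f (Vec.fromList xs)) ≡ ∑ xs (λ x → ⟦ ¬? (f x Fin.≟ 0ₚ) ⟧)
  wt-map f []       = refl
  wt-map f (x ∷ xs) = trans (wt-∷ (f x) (Vec.map f (Vec.fromList xs)))
                            (cong (⟦ ¬? (f x Fin.≟ 0ₚ) ⟧ +_) (wt-map f xs))

  wt-0ᵥ : ∀ n → wt (0ᵥ {n = n}) ≡ 0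
  wt-0ᵥ zero    = refl
  wt-0ᵥ (suc n) = trans (wt-∷ 0ₚ (0ᵥ {n = n})) (cong₂ _+_ (⟦⟧-no (¬? (0ₚ Fin.≟ 0ₚ)) (λ ne → ne refl)) (wt-0ᵥ n))

  hamming≡wt-⊖ : ∀ {n} (v w : 𝔽^ p n) → hamming v w ≡ wt (v ⊖ w)
  hamming≡wt-⊖ []      []      = refl
  hamming≡wt-⊖ (x ∷ v) (y ∷ w) = begin
    hamming (x ∷ v) (y ∷ w)                  ≡⟨ hamming-∷ ⟩
    ⟦ ¬? (x Fin.≟ y) ⟧ + hamming v w         ≡⟨ cong₂ _+_ (⟦⟧-cong (¬? (x Fin.≟ y)) (¬? (z Fin.≟ 0ₚ))
                                                  (_∘ x-y≡0⇒x≡y x y) (_∘ x≡y⇒x-y≡0)) (hamming≡wt-⊖ v w) ⟩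
    ⟦ ¬? (z Fin.≟ 0ₚ) ⟧ + wt (v ⊖ w)         ≡⟨ wt-∷ z (v ⊖ w) ⟨
    wt ((x ∷ v) ⊖ (y ∷ w))                   ∎
    where
    open ≡-Reasoning
    z : Fin p
    z = x +ₚ (-ₚ 1ₚ) *ₚ y
    hamming-∷ : hamming (x ∷ v) (y ∷ w) ≡ ⟦ ¬? (x Fin.≟ y) ⟧ + hamming v w
    hamming-∷ with x Fin.≟ y
    ... | yes _ = refl
    ... | no _  = refl

  supp-head : ∀ {n x y} (v w : 𝔽^ p n) → supp (x ∷ v) ⊆ supp (y ∷ w) → y ≡ 0ₚ → x ≡ 0ₚ
  supp-head {x = x} {y} v w sub y≡0 with x Fin.≟ 0ₚ | y Fin.≟ 0ₚ
  ... | yes x≡0 | _       = x≡0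
  ... | no _    | no y≢0  = contradiction y≡0 y≢0
  ... | no _    | yes _   with () ← sub Vec.here

  -- The words c′ + a c together have p - 1 nonzero entries in each position of
  -- the support of c and none elsewhere.
  ∑-wt-pencil : Prime p → ∀ {n} (c′ c : 𝔽^ p n) → supp c′ ⊆ supp c →
    ∑ (allFin p) (λ a → wt (c′ ⊕ a ⊙ c)) ≡ (p ∸ 1) * wt c
  ∑-wt-pencil p-prime []       []      _   =
    trans (∑-allFin-const 0) (trans (ℕ.*-zeroʳ p) (sym (ℕ.*-zeroʳ (p ∸ 1))))
  ∑-wt-pencil p-prime (x ∷ c′) (y ∷ c) sub = begin
    ∑ (allFin p) (λ a → wt ((x ∷ c′) ⊕ a ⊙ (y ∷ c)))
      ≡⟨ ∑-cong (allFin p) (λ a → wt-∷ (x +ₚ a *ₚ y) (c′ ⊕ a ⊙ c)) ⟩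
    ∑ (allFin p) (λ a → ⟦ ¬? (x +ₚ a *ₚ y Fin.≟ 0ₚ) ⟧ + wt (c′ ⊕ a ⊙ c))
      ≡⟨ ∑-+ (allFin p) (λ a → ⟦ ¬? (x +ₚ a *ₚ y Fin.≟ 0ₚ) ⟧) (λ a → wt (c′ ⊕ a ⊙ c)) ⟩
    ∑ (allFin p) (λ a → ⟦ ¬? (x +ₚ a *ₚ y Fin.≟ 0ₚ) ⟧) + ∑ (allFin p) (λ a → wt (c′ ⊕ a ⊙ c))
      ≡⟨ cong₂ _+_ (position (y Fin.≟ 0ₚ)) (∑-wt-pencil p-prime c′ c (drop-∷-⊆ sub)) ⟩
    (p ∸ 1) * ⟦ ¬? (y Fin.≟ 0ₚ) ⟧ + (p ∸ 1) * wt c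
      ≡⟨ ℕ.*-distribˡ-+ (p ∸ 1) ⟦ ¬? (y Fin.≟ 0ₚ) ⟧ (wt c) ⟨
    (p ∸ 1) * (⟦ ¬? (y Fin.≟ 0ₚ) ⟧ + wt c)
      ≡⟨ cong ((p ∸ 1) *_) (wt-∷ y c) ⟨
    (p ∸ 1) * wt (y ∷ c)
      ∎
    where
    open ≡-Reasoning
    position : (y? : Dec (y ≡ 0ₚ)) →
      ∑ (allFin p) (λ a → ⟦ ¬? (x +ₚ a *ₚ y Fin.≟ 0ₚ) ⟧) ≡ (p ∸ 1) * ⟦ ¬? y? ⟧
    position (no y≢0)  = trans (affineNonRoots p-prime x y≢0) (sym (ℕ.*-identityʳ (p ∸ 1)))
    position (yes y≡0) = trans (∑-none (allFin p) (λ a → ¬? (x +ₚ a *ₚ y Fin.≟ 0ₚ)) λ {a} _ ≢0 → ≢0 (begin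
      x +ₚ a *ₚ y     ≡⟨ cong₂ (λ x y → x +ₚ a *ₚ y) (supp-head c′ c sub y≡0) y≡0 ⟩
      0ₚ +ₚ a *ₚ 0ₚ   ≡⟨ +ₚ-identityˡ (a *ₚ 0ₚ) ⟩
      a *ₚ 0ₚ         ≡⟨ zeroʳ a ⟩
      0ₚ              ∎)) (sym (ℕ.*-zeroʳ (p ∸ 1)))

  u⊕av≡0⇒u≡-av : ∀ {n} a (u v : 𝔽^ p n) → u ⊕ a ⊙ v ≡ 0ᵥ → u ≡ (-ₚ a) ⊙ v
  u⊕av≡0⇒u≡-av a []      []      _  = refl
  u⊕av≡0⇒u≡-av a (x ∷ u) (y ∷ v) eq with eq₀ , eq₁ ← Vec.∷-injective eq =
    cong₂ _∷_ (trans (inverseˡ-unique x (a *ₚ y) eq₀) (-‿distribˡ-* a y)) (u⊕av≡0⇒u≡-av a u v eq₁)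
    where open GroupProperties +-group using (inverseˡ-unique)

-- Codes of the form 𝒞_D

  module _ {n : ℕ} {D : Pred (𝔽^ p n) 0ℓ} (D? : Decidable D) where

    private
      N : ℕ
      N = length (elements D?)

      C : Pred (𝔽^ p (length (elements D?))) 0ℓ
      C = 𝒞 D?

      cw : 𝔽^ p n → 𝔽^ p (length (elements D?))
      cw = codeword D?

    codeword-⊕ : ∀ u v → codeword D? (u ⊕ v) ≡ codeword D? u ⊕ codeword D? v
    codeword-⊕ u v = on (elements D?)
      where
      on : ∀ xs → Vec.map ((u ⊕ v) ·_) (Vec.fromList xs) ≡
                  Vec.map (u ·_) (Vec.fromList xs) ⊕ Vec.map (v ·_) (Vec.fromList xs)
      on []       = refl
      on (x ∷ xs) = cong₂ _∷_ (·-distribʳ-⊕ x u v) (on xs)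

    codeword-⊙ : ∀ a u → codeword D? (a ⊙ u) ≡ a ⊙ codeword D? u
    codeword-⊙ a u = on (elements D?)
      where
      on : ∀ xs → Vec.map ((a ⊙ u) ·_) (Vec.fromList xs) ≡ a ⊙ Vec.map (u ·_) (Vec.fromList xs)
      on []       = refl
      on (x ∷ xs) = cong₂ _∷_ (·-⊙ a u x) (on xs)

    codeword-0ᵥ : codeword D? 0ᵥ ≡ 0ᵥ
    codeword-0ᵥ = trans (cong cw (sym (⊙-zeroˡ 0ᵥ))) (trans (codeword-⊙ 0ₚ 0ᵥ) (⊙-zeroˡ (cw 0ᵥ)))

    codeword-⊖ : ∀ u v → codeword D? (u ⊖ v) ≡ codeword D? u ⊖ codeword D? v
    codeword-⊖ u v = trans (codeword-⊕ u ((-ₚ 1ₚ) ⊙ v)) (cong (cw u ⊕_) (codeword-⊙ (-ₚ 1ₚ) v))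

    codeword-lincomb : ∀ {k} (a : 𝔽^ p k) b →
      lincomb a (Vec.map (codeword D?) b) ≡ codeword D? (lincomb a b)
    codeword-lincomb []      []      = sym codeword-0ᵥ
    codeword-lincomb (x ∷ a) (v ∷ b) = begin
      x ⊙ cw v ⊕ lincomb a (Vec.map cw b)  ≡⟨ cong₂ _⊕_ (codeword-⊙ x v) (sym (codeword-lincomb a b)) ⟨
      cw (x ⊙ v) ⊕ cw (lincomb a b)        ≡⟨ codeword-⊕ (x ⊙ v) (lincomb a b) ⟨
      cw (x ⊙ v ⊕ lincomb a b)             ∎
      where open ≡-Reasoning

    𝒞-linear : IsLinear (𝒞 D?)
    𝒞-linear = record
      { 0∈       = 0ᵥ , sym codeword-0ᵥ
      ; ⊕-closed = λ { (u , refl) (v , refl) → u ⊕ v , sym (codeword-⊕ u v) }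
      ; ⊙-closed = λ { a (u , refl) → a ⊙ u , sym (codeword-⊙ a u) } }

    -- Suppose that the codewords of nonzero vectors have weight at least d > 0.
    -- Then the vectors are determined by their codewords.
    module _ {d : ℕ} (0<d : 0 < d) (wt≥d : ∀ u → u ≢ 0ᵥ → d ≤ wt (codeword D? u)) where

      codeword-nonzero : ∀ {u} → codeword D? u ≡ 0ᵥ → u ≡ 0ᵥ
      codeword-nonzero {u} cu≡0 with u ≟ᵥ 0ᵥ
      ... | yes u≡0 = u≡0
      ... | no u≢0  = contradiction (ℕ.≤-trans 0<d (wt≥d u u≢0))
                        (ℕ.≤⇒≯ (ℕ.≤-reflexive (trans (cong wt cu≡0) (wt-0ᵥ N))))

      codeword-injective : ∀ {u v} → codeword D? u ≡ codeword D? v → u ≡ v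
      codeword-injective {u} {v} eq = u⊖v≡0⇒u≡v u v (codeword-nonzero (begin
        cw (u ⊖ v)    ≡⟨ codeword-⊖ u v ⟩
        cw u ⊖ cw v   ≡⟨ cong (_⊖ cw v) eq ⟩
        cw v ⊖ cw v   ≡⟨ codeword-⊖ v v ⟨
        cw (v ⊖ v)    ≡⟨ cong cw (self v) ⟩
        cw 0ᵥ         ≡⟨ codeword-0ᵥ ⟩
        0ᵥ            ∎))
        where
        open ≡-Reasoning
        self : ∀ {k} (v : 𝔽^ p k) → v ⊖ v ≡ 0ᵥ
        self []      = refl
        self (x ∷ v) = cong₂ _∷_ (x≡y⇒x-y≡0 refl) (self v)

      𝒞-dimension : HasDimension (𝒞 D?) n
      𝒞-dimension = Vec.map cw (units n) , record
        { members     = λ i → lookup (units n) i , Vec.lookup-map i cw (units n)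
        ; independent = λ a eq → codeword-nonzero (trans (sym (spans a)) eq)
        ; spanning    = λ { c (u , c≡cu) → u , trans c≡cu (sym (spans u)) } }
        where
        spans : ∀ a → lincomb a (Vec.map cw (units n)) ≡ cw a
        spans a = trans (codeword-lincomb a (units n)) (cong cw (lincomb-units a))

      𝒞-minDistance : ∀ u → wt (codeword D? u) ≡ d → HasMinDistance (𝒞 D?) d
      𝒞-minDistance u wt≡d = record
        { attained = cw u , 0ᵥ , (u , refl) , IsLinear.0∈ 𝒞-linear
                   , (λ cu≡0 → ℕ.<⇒≢ 0<d (trans (sym (wt-0ᵥ N)) (trans (cong wt (sym cu≡0)) wt≡d)))
                   , trans (hamming≡wt-⊖ (cw u) 0ᵥ) (trans (cong wt (⊖-identityʳ (cw u))) wt≡d)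
        ; bound    = λ { _ _ (v , refl) (w , refl) cv≢cw →
            subst (d ≤_) (sym (trans (hamming≡wt-⊖ (cw v) (cw w)) (cong wt (sym (codeword-⊖ v w)))))
                  (wt≥d (v ⊖ w) (λ v⊖w≡0 → cv≢cw (cong cw (u⊖v≡0⇒u≡v v w v⊖w≡0)))) } }

      𝒞-weightDistribution : ∀ w → HasSize (λ c → 𝒞 D? c × c ≢ 0ᵥ × wt c ≡ w)
        (∑ (allVectors p n) (λ u → ⟦ ¬? (u ≟ᵥ 0ᵥ) ×-dec (wt (codeword D? u) ℕ.≟ w) ⟧))
      𝒞-weightDistribution w =
        map cw (filter P? (allVectors p n))
        , Unique.map⁺ codeword-injective (Unique.filter⁺ P? (allVectors-unique n))
        , (λ c → mk⇔ to from)
        , trans (List.length-map cw (filter P? (allVectors p n))) (length-filter≡∑ P? (allVectors p n))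
        where
        P? : Decidable (λ u → u ≢ 0ᵥ × wt (cw u) ≡ w)
        P? u = ¬? (u ≟ᵥ 0ᵥ) ×-dec (wt (cw u) ℕ.≟ w)
        to : ∀ {c} → c ∈ map cw (filter P? (allVectors p n)) → C c × c ≢ 0ᵥ × wt c ≡ w
        to c∈ with u , u∈ , refl ← ∈-map⁻ cw c∈
              with _ , u≢0 , wt≡w ← ∈-filter⁻ P? {xs = allVectors p n} u∈ =
          (u , refl) , u≢0 ∘ codeword-nonzero , wt≡w
        from : ∀ {c} → C c × c ≢ 0ᵥ × wt c ≡ w → c ∈ map cw (filter P? (allVectors p n))
        from ((u , refl) , cu≢0 , wt≡w) =
          ∈-map⁺ cw (∈-filter⁺ P? (allVectors-complete u)
            ((λ u≡0 → cu≢0 (trans (cong cw u≡0) codeword-0ᵥ)) , wt≡w))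

      -- The Ashikhmin-Barg criterion: the code is minimal if the ratio of the
      -- smallest to the largest weight exceeds (p - 1) / p.  If the support of c′ lies
      -- in that of c, but c′ is no multiple of c, then the p words c′ + a c are all
      -- nonzero, and the sum of their weights is at once at least p d and at most
      -- (p - 1) M.
      ashikhminBarg : Prime p → ∀ {M} → (∀ u → wt (codeword D? u) ≤ M) →
        (p ∸ 1) * M < p * d → IsMinimal (𝒞 D?)
      ashikhminBarg p-prime {M} wt≤M gap _ (u , refl) cu≢0 = (u , refl) , cu≢0 , multiple
        where
        multiple : ∀ c′ → C c′ → supp c′ ⊆ supp (cw u) → ∃ λ a → c′ ≡ a ⊙ cw u
        multiple _ (v , refl) sub with Fin.any? (λ a → v ⊕ a ⊙ u ≟ᵥ 0ᵥ)
        ... | yes (a , eq) = -ₚ a , trans (cong cw (u⊕av≡0⇒u≡-av a v u eq)) (codeword-⊙ (-ₚ a) u)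
        ... | no  never    = contradiction gap (ℕ.≤⇒≯ (begin
          p * d                                       ≡⟨ ∑-allFin-const d ⟨
          ∑ (allFin p) (λ _ → d)                      ≤⟨ ∑-≤ (allFin p) (λ a → wt≥d (v ⊕ a ⊙ u) (λ eq → never (a , eq))) ⟩
          ∑ (allFin p) (λ a → wt (cw (v ⊕ a ⊙ u)))    ≡⟨ ∑-cong (allFin p) (λ a → cong wt
                                                           (trans (codeword-⊕ v (a ⊙ u)) (cong (cw v ⊕_) (codeword-⊙ a u)))) ⟩
          ∑ (allFin p) (λ a → wt (cw v ⊕ a ⊙ cw u))   ≡⟨ ∑-wt-pencil p-prime (cw v) (cw u) sub ⟩
          (p ∸ 1) * wt (cw u)                         ≤⟨ ℕ.*-monoʳ-≤ (p ∸ 1) (wt≤M u) ⟩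
          (p ∸ 1) * M                                 ∎))
          where open ℕ.≤-Reasoning

-- The ideals contained in I

  toℕ-mod-< : ∀ {a} → a < p → toℕ (a mod p) ≡ a
  toℕ-mod-< {a} a<p = trans (toℕ-mod a) (m<n⇒m%n≡m a<p)

  toℕ-0ₚ : toℕ 0ₚ ≡ 0
  toℕ-0ₚ = toℕ-mod-< (>-nonZero⁻¹ p)

  toℕ≡0⇒≡0ₚ : ∀ {x : Fin p} → toℕ x ≡ 0 → x ≡ 0ₚ
  toℕ≡0⇒≡0ₚ eq = Fin.toℕ-injective (trans eq (sym toℕ-0ₚ))

  p∸1<p : p ∸ 1 < p
  p∸1<p = ℕ.≤-reflexive (trans (ℕ.+-comm 1 (p ∸ 1)) (ℕ.m∸n+n≡m (>-nonZero⁻¹ p)))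

  toℕ≤p∸1 : ∀ (x : Fin p) → toℕ x ≤ p ∸ 1
  toℕ≤p∸1 x = ℕ.∸-monoˡ-≤ 1 (Fin.toℕ<n x)

  -1ₚ≡p∸1 : 1 < p → -ₚ 1ₚ ≡ (p ∸ 1) mod p
  -1ₚ≡p∸1 1<p = cong (λ k → (p ∸ k) mod p) (toℕ-mod-< 1<p)

  toℕ--1ₚ : 1 < p → toℕ (-ₚ 1ₚ) ≡ p ∸ 1
  toℕ--1ₚ 1<p = trans (cong toℕ (-1ₚ≡p∸1 1<p)) (toℕ-mod-< p∸1<p)

  -1ₚ≢0 : 1 < p → -ₚ 1ₚ ≢ 0ₚ
  -1ₚ≢0 1<p -1≡0 = ℕ.<⇒≢ (ℕ.∸-monoˡ-≤ 1 1<p)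
    (trans (sym toℕ-0ₚ) (trans (cong toℕ (sym -1≡0)) (toℕ--1ₚ 1<p)))

  vector-ext : ∀ {n} {u v : 𝔽^ p n} → (∀ i → lookup u i ≡ lookup v i) → u ≡ v
  vector-ext {u = u} {v} eq =
    trans (sym (Vec.tabulate∘lookup u)) (trans (Vec.tabulate-cong eq) (Vec.tabulate∘lookup v))

  ∈supp⁺ : ∀ {n} (v : 𝔽^ p n) {i} → lookup v i ≢ 0ₚ → i ∈ₛ supp v
  ∈supp⁺ (x ∷ v) {zero} x≢0 with x Fin.≟ 0ₚ
  ... | yes x≡0 = contradiction x≡0 x≢0
  ... | no _    = Vec.here
  ∈supp⁺ (x ∷ v) {suc i} vᵢ≢0 = Vec.there (∈supp⁺ v vᵢ≢0)

  ∈supp⁻ : ∀ {n} (v : 𝔽^ p n) {i} → i ∈ₛ supp v → lookup v i ≢ 0ₚ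
  ∈supp⁻ (x ∷ v) {zero} i∈ x≡0 with x Fin.≟ 0ₚ | i∈
  ... | yes _  | ()
  ... | no x≢0 | _  = x≢0 x≡0
  ∈supp⁻ (x ∷ v) {suc i} (Vec.there i∈) = ∈supp⁻ v i∈

  module _ {n : ℕ} {m : ℕ} {a b : Fin p} where

    private
      -- The function which stair tabulates, recovered by unification.
      stair-entries : ∃ λ f → stair {n = n} m a b ≡ tabulate f
      stair-entries = _ , refl

      lookup-stair : ∀ i → lookup (stair {n = n} m a b) i ≡ proj₁ stair-entries i
      lookup-stair = Vec.lookup∘tabulate (proj₁ stair-entries)

    stair-< : ∀ {i} → toℕ i < m → lookup (stair {n = n} m a b) i ≡ a
    stair-< {i} i<m with ℕ.<-cmp (toℕ i) m | lookup-stair i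
    ... | tri< _ _ _   | eq = eq
    ... | tri≈ i≮m _ _ | eq = contradiction i<m i≮m
    ... | tri> i≮m _ _ | eq = contradiction i<m i≮m

    stair-≡ : ∀ {i} → toℕ i ≡ m → lookup (stair {n = n} m a b) i ≡ b
    stair-≡ {i} i≡m with ℕ.<-cmp (toℕ i) m | lookup-stair i
    ... | tri< _ i≢m _ | eq = contradiction i≡m i≢m
    ... | tri≈ _ _ _   | eq = eq
    ... | tri> _ i≢m _ | eq = contradiction i≡m i≢m

    stair-> : ∀ {i} → m < toℕ i → lookup (stair {n = n} m a b) i ≡ 0ₚ
    stair-> {i} m<i with ℕ.<-cmp (toℕ i) m | lookup-stair i
    ... | tri< _ _ m≮i | eq = contradiction m<i m≮i
    ... | tri≈ _ _ m≮i | eq = contradiction m<i m≮i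
    ... | tri> _ _ _   | eq = eq

    ≡stair : ∀ {v : 𝔽^ p n} → (∀ {i} → toℕ i < m → lookup v i ≡ a) →
      (∀ {i} → toℕ i ≡ m → lookup v i ≡ b) → (∀ {i} → m < toℕ i → lookup v i ≡ 0ₚ) →
      v ≡ stair m a b
    ≡stair {v} below at above = vector-ext entry
      where
      entry : ∀ i → lookup v i ≡ lookup (stair m a b) i
      entry i with ℕ.<-cmp (toℕ i) m
      ... | tri< i<m _ _ = trans (below i<m) (sym (stair-< i<m))
      ... | tri≈ _ i≡m _ = trans (at i≡m) (sym (stair-≡ i≡m))
      ... | tri> _ _ m<i = trans (above m<i) (sym (stair-> m<i))

  module _ (1<p : 1 < p) {n m t : ℕ} (m<n : m < n) (t<p : t < p) where

    private
      I : 𝔽^ p n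
      I = idealI m t

      μ : Fin n
      μ = Fin.fromℕ< m<n

      toℕ-μ : toℕ μ ≡ m
      toℕ-μ = Fin.toℕ-fromℕ< m<n

    ideal⇒explicit : ∀ x → Ideals m I x → ExplicitIdeals m t x
    ideal⇒explicit x ((_ , full) , x⊑I) with lookup x μ Fin.≟ 0ₚ
    ... | yes xμ≡0 = inj₁ upper
      where
      upper : ∀ i → m ≤ toℕ i → lookup x i ≡ 0ₚ
      upper i m≤i with ℕ.m≤n⇒m<n∨m≡n m≤i
      ... | inj₁ m<i = toℕ≡0⇒≡0ₚ (ℕ.n≤0⇒n≡0
            (ℕ.≤-trans (x⊑I i) (ℕ.≤-reflexive (trans (cong toℕ (stair-> m<i)) toℕ-0ₚ))))
      ... | inj₂ m≡i = trans (cong (lookup x) (Fin.toℕ-injective (trans (sym m≡i) (sym toℕ-μ)))) xμ≡0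
    ... | no xμ≢0 = inj₂ (toℕ (lookup x μ) , ℕ.n≢0⇒n>0 (xμ≢0 ∘ toℕ≡0⇒≡0ₚ) , xμ≤t , ≡stair below at above)
      where
      xμ≤t : toℕ (lookup x μ) ≤ t
      xμ≤t = ℕ.≤-trans (x⊑I μ) (ℕ.≤-reflexive (trans (cong toℕ (stair-≡ toℕ-μ)) (toℕ-mod-< t<p)))
      below : ∀ {i} → toℕ i < m → lookup x i ≡ -ₚ 1ₚ
      below {i} i<m = Fin.toℕ-injective
        (trans (full i μ (∈supp⁺ x xμ≢0) (i<m , ℕ.≤-reflexive (sym toℕ-μ))) (sym (toℕ--1ₚ 1<p)))
      at : ∀ {i} → toℕ i ≡ m → lookup x i ≡ toℕ (lookup x μ) mod p
      at i≡m = trans (cong (lookup x) (Fin.toℕ-injective (trans i≡m (sym toℕ-μ)))) (sym (mod-toℕ (lookup x μ)))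
      above : ∀ {i} → m < toℕ i → lookup x i ≡ 0ₚ
      above {i} m<i = toℕ≡0⇒≡0ₚ (ℕ.n≤0⇒n≡0
        (ℕ.≤-trans (x⊑I i) (ℕ.≤-reflexive (trans (cong toℕ (stair-> m<i)) toℕ-0ₚ))))

    private
      below-I : ∀ (x : 𝔽^ p n) i → toℕ i < m → toℕ (lookup x i) ≤ toℕ (lookup I i)
      below-I x i i<m = ℕ.≤-trans (toℕ≤p∸1 (lookup x i))
        (ℕ.≤-reflexive (sym (trans (cong toℕ (stair-< i<m)) (toℕ-mod-< p∸1<p))))

      zero-≤-I : ∀ (x : 𝔽^ p n) i → lookup x i ≡ 0ₚ → toℕ (lookup x i) ≤ toℕ (lookup I i)
      zero-≤-I x i xᵢ≡0 = subst (_≤ toℕ (lookup I i)) (sym (trans (cong toℕ xᵢ≡0) toℕ-0ₚ)) z≤n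

    explicit⇒ideal : ∀ x → ExplicitIdeals m t x → Ideals m I x
    explicit⇒ideal x (inj₁ upper) = (ideal , full) , x⊑I
      where
      ideal : IsOrderIdeal m (supp x)
      ideal i j (inj₁ refl)      j∈ = j∈
      ideal i j (inj₂ (_ , m≤j)) j∈ = contradiction (upper j m≤j) (∈supp⁻ x j∈)
      full : ∀ i j → j ∈ₛ supp x → _≺_ m i j → toℕ (lookup x i) ≡ p ∸ 1
      full i j j∈ (_ , m≤j) = contradiction (upper j m≤j) (∈supp⁻ x j∈)
      x⊑I : x ⊑ I
      x⊑I i with toℕ i ℕ.<? m
      ... | yes i<m = below-I x i i<m
      ... | no i≮m  = zero-≤-I x i (upper i (ℕ.≮⇒≥ i≮m))
    explicit⇒ideal x (inj₂ (j , 1≤j , j≤t , refl)) = (ideal , full) , x⊑I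
      where
      ideal : IsOrderIdeal m (supp x)
      ideal i k (inj₁ refl)      k∈ = k∈
      ideal i k (inj₂ (i<m , _)) k∈ = ∈supp⁺ x (λ xᵢ≡0 → -1ₚ≢0 1<p (trans (sym (stair-< i<m)) xᵢ≡0))
      full : ∀ i k → k ∈ₛ supp x → _≺_ m i k → toℕ (lookup x i) ≡ p ∸ 1
      full i k k∈ (i<m , _) = trans (cong toℕ (stair-< i<m)) (toℕ--1ₚ 1<p)
      x⊑I : x ⊑ I
      x⊑I i with ℕ.<-cmp (toℕ i) m
      ... | tri< i<m _ _ = below-I x i i<m
      ... | tri> _ _ m<i = zero-≤-I x i (stair-> m<i)
      ... | tri≈ _ i≡m _ = begin
        toℕ (lookup x i)   ≡⟨ cong toℕ (stair-≡ i≡m) ⟩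
        toℕ (j mod p)      ≡⟨ toℕ-mod-< (ℕ.≤-<-trans j≤t t<p) ⟩
        j                  ≤⟨ j≤t ⟩
        t                  ≡⟨ toℕ-mod-< t<p ⟨
        toℕ (t mod p)      ≡⟨ cong toℕ (stair-≡ i≡m) ⟨
        toℕ (lookup I i)   ∎
        where open ℕ.≤-Reasoning

    I-saturated : 1 ≤ t → IsSaturated m I
    I-saturated 1≤t = proj₁ (explicit⇒ideal I
      (inj₂ (t , 1≤t , ℕ.≤-refl , cong (λ a → stair m a (t mod p)) (sym (-1ₚ≡p∸1 1<p)))))

  stair≡++ : ∀ m {r} (a b : Fin p) → replicate m a ++ b ∷ 0ᵥ {n = r} ≡ stair m a b
  stair≡++ m {r} a b = ≡stair (below m) (at m) (above m)
    where
    below : ∀ m {i : Fin (m + suc r)} → toℕ i < m → lookup (replicate m a ++ b ∷ 0ᵥ) i ≡ a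
    below (suc m) {zero}  _         = refl
    below (suc m) {suc i} (s≤s i<m) = below m i<m
    at : ∀ m {i : Fin (m + suc r)} → toℕ i ≡ m → lookup (replicate m a ++ b ∷ 0ᵥ) i ≡ b
    at zero    {zero}  _  = refl
    at (suc m) {suc i} eq = at m (ℕ.suc-injective eq)
    above : ∀ m {i : Fin (m + suc r)} → m < toℕ i → lookup (replicate m a ++ b ∷ 0ᵥ) i ≡ 0ₚ
    above zero    {suc i} _         = Vec.lookup-replicate i 0ₚ
    above (suc m) {suc i} (s≤s m<i) = above m m<i

  -- The residues of 1, …, t, called steps.
  steps : ℕ → List (Fin p)
  steps t = List.tabulate {n = t} (λ i → suc (toℕ i) mod p)

  module _ {t : ℕ} (t<p : t < p) where

    private
      toℕ-step : ∀ (i : Fin t) → toℕ (suc (toℕ i) mod p) ≡ suc (toℕ i)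
      toℕ-step i = toℕ-mod-< (ℕ.≤-<-trans (Fin.toℕ<n i) t<p)

    steps-unique : Unique (steps t)
    steps-unique = Unique.tabulate⁺ λ {i} {j} eq → Fin.toℕ-injective (ℕ.suc-injective
      (trans (sym (toℕ-step i)) (trans (cong toℕ eq) (toℕ-step j))))

    steps-nonzero : ∀ {j} → j ∈ steps t → j ≢ 0ₚ
    steps-nonzero j∈ j≡0 with i , refl ← ∈-tabulate⁻ j∈ =
      ℕ.1+n≢0 (trans (sym (toℕ-step i)) (trans (cong toℕ j≡0) toℕ-0ₚ))

  -- The ideals contained in I: 𝔽ₚᵐ × 0 and the vectors (-1, …, -1, j, 0, …, 0) for
  -- the steps j.
  idealList : ∀ m t r → List (𝔽^ p (m + suc r))
  idealList m t r = map (_++ 0ᵥ) (allVectors p m) List.++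
                    map (λ j → replicate m (-ₚ 1ₚ) ++ j ∷ 0ᵥ) (steps t)

  idealList-unique : ∀ m {t} r → t < p → Unique (idealList m t r)
  idealList-unique m r t<p = Unique.++⁺
    (Unique.map⁺ (λ {v} {w} → Vec.++-injectiveˡ v w) (allVectors-unique m))
    (Unique.map⁺ (λ eq → Vec.∷-injectiveˡ (Vec.++-injectiveʳ (replicate m _) (replicate m _) eq))
                 (steps-unique t<p))
    disjoint
    where
    disjoint : ∀ {x} → ¬ (x ∈ map (_++ 0ᵥ) (allVectors p m) ×
                          x ∈ map (λ j → replicate m (-ₚ 1ₚ) ++ j ∷ 0ᵥ) (steps _))
    disjoint (x∈₁ , x∈₂) with v , _ , refl ← ∈-map⁻ (_++ 0ᵥ) x∈₁
                         with j , j∈ , eq ← ∈-map⁻ (λ j → replicate m (-ₚ 1ₚ) ++ j ∷ 0ᵥ) x∈₂ =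
      steps-nonzero t<p j∈ (sym (Vec.∷-injectiveˡ (Vec.++-injectiveʳ v (replicate m _) eq)))

  idealList⇔explicit : ∀ m t r x → x ∈ idealList m t r ⇔ ExplicitIdeals m t x
  idealList⇔explicit m t r _ = mk⇔ to from
    where
    flat : 𝔽^ p m → 𝔽^ p (m + suc r)
    flat = _++ 0ᵥ
    stepped : Fin p → 𝔽^ p (m + suc r)
    stepped j = replicate m (-ₚ 1ₚ) ++ j ∷ 0ᵥ
    flat-upper : ∀ {m} (v : 𝔽^ p m) i → m ≤ toℕ i → lookup (v ++ 0ᵥ {n = suc r}) i ≡ 0ₚ
    flat-upper []      i       _         = Vec.lookup-replicate i 0ₚ
    flat-upper (x ∷ v) (suc i) (s≤s m≤i) = flat-upper v i m≤i
    upper-flat : ∀ m (x : 𝔽^ p (m + suc r)) → (∀ i → m ≤ toℕ i → lookup x i ≡ 0ₚ) →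
      ∃ λ (v : 𝔽^ p m) → x ≡ v ++ 0ᵥ
    upper-flat zero    x       upper =
      [] , vector-ext (λ i → trans (upper i z≤n) (sym (Vec.lookup-replicate i 0ₚ)))
    upper-flat (suc m) (y ∷ x) upper
      with v , refl ← upper-flat m x (λ i m≤i → upper (suc i) (s≤s m≤i)) = y ∷ v , refl
    to : ∀ {x} → x ∈ idealList m t r → ExplicitIdeals m t x
    to x∈ with ∈-++⁻ (map flat (allVectors p m)) x∈
    ... | inj₁ x∈₁ with v , _ , refl ← ∈-map⁻ flat x∈₁ = inj₁ (flat-upper v)
    ... | inj₂ x∈₂ with j , j∈ , refl ← ∈-map⁻ stepped x∈₂ with i , refl ← ∈-tabulate⁻ j∈ =
      inj₂ (suc (toℕ i) , s≤s z≤n , Fin.toℕ<n i , stair≡++ m (-ₚ 1ₚ) (suc (toℕ i) mod p))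
    from : ∀ {x} → ExplicitIdeals m t x → x ∈ idealList m t r
    from {x} (inj₁ upper) with v , refl ← upper-flat m x upper =
      ∈-++⁺ˡ (∈-map⁺ flat (allVectors-complete v))
    from (inj₂ (suc j , _ , j<t , x≡stair)) =
      subst (_∈ idealList m t r) (trans (stair≡++ m (-ₚ 1ₚ) (suc j mod p)) (sym x≡stair))
        (∈-++⁺ʳ (map flat (allVectors p m)) (∈-map⁺ stepped
          (subst (λ k → suc k mod p ∈ steps t) (Fin.toℕ-fromℕ< j<t) (∈-tabulate⁺ (Fin.fromℕ< j<t)))))

  -- A sum over 𝔽ₚⁿ splits into the sums over a set and over its complement.
  ∑-complementary : ∀ {n} {D : Pred (𝔽^ p n) 0ℓ} (D? : Decidable D) {xs} → Unique xs →
    (∀ x → D x ⇔ (¬ x ∈ xs)) → ∀ f → ∑ (elements D?) f + ∑ xs f ≡ ∑ (allVectors p n) f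
  ∑-complementary {n} {D} D? {xs} xs! D⇔∉xs f =
    trans (sym (∑-++ (elements D?) xs f))
          (∑-↭ f (∼bag⇒↭ (unique∧set⇒bag
            (Unique.++⁺ (Unique.filter⁺ D? (allVectors-unique n)) xs! disjoint)
            (allVectors-unique n) (mk⇔ (λ _ → allVectors-complete _) (λ _ → covers _)))))
    where
    disjoint : ∀ {x} → ¬ (x ∈ elements D? × x ∈ xs)
    disjoint (x∈D , x∈xs) =
      Equivalence.to (D⇔∉xs _) (proj₂ (∈-filter⁻ D? {xs = allVectors p n} x∈D)) x∈xs
    covers : ∀ x → x ∈ elements D? List.++ xs
    covers x with Any.any? (x ≟ᵥ_) xs
    ... | yes x∈xs = ∈-++⁺ʳ (elements D?) x∈xs
    ... | no x∉xs  = ∈-++⁺ˡ (∈-filter⁺ D? (allVectors-complete x) (Equivalence.from (D⇔∉xs x) x∉xs))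

-- Weight tables and sums of rounded quotients

-- In a list of rows (weight , frequency), the total frequency of the weight w.
frequency : ℕ → List (ℕ × ℕ) → ℕ
frequency w rows = ∑ rows (λ row → proj₂ row * ⟦ proj₁ row ℕ.≟ w ⟧)

sum-filter≡frequency : ∀ w rows →
  sum (map proj₂ (filter (λ row → proj₁ row ℕ.≟ w) rows)) ≡ frequency w rows
sum-filter≡frequency w []               = refl
sum-filter≡frequency w ((v , f) ∷ rows) with does (v ℕ.≟ w)
... | true  = cong₂ _+_ (sym (ℕ.*-identityʳ f)) (sum-filter≡frequency w rows)
... | false = trans (sum-filter≡frequency w rows) (cong (_+ frequency w rows) (sym (ℕ.*-zeroʳ f)))

-- The weight table in terms of its smallest weight d and of e = (p-1) p^(m-1), free
-- of truncated subtraction in the weights.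
table : (d t e : ℕ) (f₁ f₂ f₃ f₄ f₅ : ℕ) → List (ℕ × ℕ)
table d t e f₁ f₂ f₃ f₄ f₅ =
  (d , f₁) ∷ (d + 1 , f₂) ∷ (d + t , f₃) ∷ (d + e , f₄) ∷ (d + e + t , f₅) ∷ []

table-cong : ∀ d t e {f₁ f₂ f₃ f₄ f₅ g₁ g₂ g₃ g₄ g₅} →
  f₁ ≡ g₁ → f₂ ≡ g₂ → f₃ ≡ g₃ → f₄ ≡ g₄ → f₅ ≡ g₅ →
  table d t e f₁ f₂ f₃ f₄ f₅ ≡ table d t e g₁ g₂ g₃ g₄ g₅
table-cong d t e refl refl refl refl refl = refl

∑-frequency-table : ∀ (xs : List A) d t e w (f₁ f₂ f₃ f₄ f₅ : A → ℕ) →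
  ∑ xs (λ x → frequency w (table d t e (f₁ x) (f₂ x) (f₃ x) (f₄ x) (f₅ x))) ≡
  frequency w (table d t e (∑ xs f₁) (∑ xs f₂) (∑ xs f₃) (∑ xs f₄) (∑ xs f₅))
∑-frequency-table xs d t e w f₁ f₂ f₃ f₄ f₅ =
  row f₁ (row f₂ (row f₃ (row f₄ (row f₅ (trans (∑-const xs 0) (ℕ.*-zeroʳ (length xs)))))))
  where
  row : ∀ f {k g s} → ∑ xs g ≡ s → ∑ xs (λ x → f x * k + g x) ≡ ∑ xs f * k + s
  row f {k} {g} eq = trans (∑-+ xs (λ x → f x * k) g) (cong₂ _+_ (∑-*ʳ xs f k) eq)

inhabited⇒positiveSize : {P : Pred A 0ℓ} → ∀ {k} → HasSize P k → ∃ P → 0 < k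
inhabited⇒positiveSize (xs , _ , xs⇔P , refl) (x , Px) = nonempty (Equivalence.from (xs⇔P x) Px)
  where
  nonempty : ∀ {xs} → x ∈ xs → 0 < length xs
  nonempty (here _)  = s≤s z≤n
  nonempty (there _) = s≤s z≤n

positiveSize⇒inhabited : {P : Pred A 0ℓ} → ∀ {k} → HasSize P k → 0 < k → ∃ P
positiveSize⇒inhabited (x ∷ xs , _ , xs⇔P , refl) _ = x , Equivalence.to (xs⇔P x) (here refl)

positive⇒occurs : ∀ w rows → 0 < frequency w rows →
  Any (λ row → proj₁ row ≡ w × 0 < proj₂ row) rows
positive⇒occurs w ((v , f) ∷ rows) = on f (v ℕ.≟ w)
  where
  on : ∀ f (v? : Dec (v ≡ w)) → 0 < f * ⟦ v? ⟧ + frequency w rows →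
    Any (λ row → proj₁ row ≡ w × 0 < proj₂ row) ((v , f) ∷ rows)
  on (suc f) (yes v≡w) _     = here (v≡w , s≤s z≤n)
  on zero    (yes v≡w) 0<sum = there (positive⇒occurs w rows 0<sum)
  on f       (no _)    0<sum =
    there (positive⇒occurs w rows (subst (λ k → 0 < k + frequency w rows) (ℕ.*-zeroʳ f) 0<sum))

occurs⇒positive : ∀ w {rows} → Any (λ row → proj₁ row ≡ w × 0 < proj₂ row) rows → 0 < frequency w rows
occurs⇒positive w {(v , f) ∷ rows} (here (v≡w , 0<f)) = ℕ.≤-trans
  (subst (λ k → 0 < f * k) (sym (⟦⟧-yes (v ℕ.≟ w) v≡w)) (ℕ.*-mono-≤ 0<f ℕ.≤-refl)) (ℕ.m≤m+n _ _)
occurs⇒positive w {(v , f) ∷ rows} (there occurs) = ℕ.≤-trans (occurs⇒positive w occurs) (ℕ.m≤n+m _ _)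

-- The terms of a sum telescope against a rising and a falling sequence.
telescope : ∀ n (f g h : ℕ → ℕ) → (∀ i → i < n → f i + g (suc i) + h i ≡ g i + h (suc i)) →
  sum (applyUpTo f n) + g n + h 0 ≡ g 0 + h n
telescope zero    f g h step = refl
telescope (suc n) f g h step = ℕ.+-cancelʳ-≡ (g 1 + h 1) _ _ (begin
  f 0 + S + g (suc n) + h 0 + (g 1 + h 1)        ≡⟨ rearrange (f 0) S (g (suc n)) (h 0) (g 1) (h 1) ⟩
  (f 0 + g 1 + h 0) + (S + g (suc n) + h 1)      ≡⟨ cong₂ _+_ (step 0 (s≤s z≤n))
                                                      (telescope n (f ∘ suc) (g ∘ suc) (h ∘ suc) (λ i → step (suc i) ∘ s≤s)) ⟩
  (g 0 + h 1) + (g 1 + h (suc n))                ≡⟨ regroup (g 0) (h 1) (g 1) (h (suc n)) ⟩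
  g 0 + h (suc n) + (g 1 + h 1)                  ∎)
  where
  open ≡-Reasoning
  S : ℕ
  S = sum (applyUpTo (f ∘ suc) n)
  rearrange : ∀ f S g h g₁ h₁ → f + S + g + h + (g₁ + h₁) ≡ (f + g₁ + h) + (S + g + h₁)
  rearrange = solve-∀
  regroup : ∀ a b c d → (a + b) + (c + d) ≡ a + d + (c + b)
  regroup = solve-∀

-- Rounding up: if k b exceeds a by less than b, then k is the ceiling of a / b.
ceiling : ∀ {a b s} .{{_ : NonZero b}} k → k * b ≡ a + s → s < b → (a + (b ∸ 1)) / b ≡ k
ceiling {a} {b} {s} k kb≡a+s s<b = begin
  (a + (b ∸ 1)) / b          ≡⟨ cong (λ x → (a + x) / b) (ℕ.m∸n+n≡m s≤b∸1) ⟨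
  (a + (b ∸ 1 ∸ s + s)) / b  ≡⟨ cong (_/ b) (trans (rearrange a (b ∸ 1 ∸ s) s) (cong (b ∸ 1 ∸ s +_) (sym kb≡a+s))) ⟩
  (b ∸ 1 ∸ s + k * b) / b    ≡⟨ +-distrib-/-∣ʳ (b ∸ 1 ∸ s) (divides k refl) ⟩
  (b ∸ 1 ∸ s) / b + k * b / b
                             ≡⟨ cong₂ _+_ (m<n⇒m/n≡0 (ℕ.≤-<-trans (ℕ.m∸n≤m (b ∸ 1) s) b∸1<b)) (m*n/n≡m k b) ⟩
  k                          ∎
  where
  open ≡-Reasoning
  s≤b∸1 : s ≤ b ∸ 1
  s≤b∸1 = ℕ.∸-monoˡ-≤ 1 s<b
  b∸1<b : b ∸ 1 < b
  b∸1<b = p∸1<p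
  rearrange : ∀ a x s → a + (x + s) ≡ x + (a + s)
  rearrange = solve-∀

-- The weights and their frequencies

-- Here m = m₁ + 1, n = m + 1 + r, and D is the complement of the listed ideals.
module Weights
  {p : ℕ} .{{_ : NonZero p}} (p-prime : Prime p) (2<p : 2 < p)
  (m₁ r t : ℕ) (1≤m₁ : 1 ≤ m₁) (1≤t : 1 ≤ t) (t<p : t < p)
  {D : Pred (𝔽^ p (suc m₁ + suc r)) 0ℓ} (D? : Decidable D)
  (D⇔∉ideals : ∀ x → D x ⇔ (¬ x ∈ idealList (suc m₁) t r))
  where

  open CommutativeRing (𝔽-ring p) using (zeroˡ; zeroʳ; +-identityʳ)

  -- The numbers e and T count the vectors off a linear hyperplane in 𝔽ₚᵐ and in
  -- 𝔽ₚⁿ; d is the minimum distance.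
  m n q c e T d : ℕ
  m = suc m₁
  n = m + suc r
  q = p ^ m₁
  c = p ^ r
  e = (p ∸ 1) * q
  T = (p ∸ 1) * p ^ (m₁ + suc r)
  d = minDist p m n t

  1<p : 1 < p
  1<p = ℕ.<-trans (s≤s (s≤s z≤n)) 2<p

  -- The weight of the codeword of u.
  W : 𝔽^ p n → ℕ
  W u = wt (codeword D? u)

  ∑-split-ideals : ∀ f → ∑ (elements D?) f + ∑ (idealList m t r) f ≡ ∑ (allVectors p n) f
  ∑-split-ideals = ∑-complementary D? (idealList-unique m r t<p) D⇔∉ideals

  ∑-idealList : ∀ f → ∑ (idealList m t r) f ≡
    ∑ (allVectors p m) (λ x → f (x ++ 0ᵥ)) + ∑ (steps t) (λ j → f (replicate m (-ₚ 1ₚ) ++ j ∷ 0ᵥ))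
  ∑-idealList f = trans (∑-++ (map (_++ 0ᵥ) (allVectors p m)) _ f)
    (cong₂ _+_ (∑-map (_++ 0ᵥ) (allVectors p m) f) (∑-map _ (steps t) f))

  length-elements : length (elements D?) + (p ^ m + t) ≡ p ^ n
  length-elements = begin
    length (elements D?) + (p ^ m + t)
      ≡⟨ cong₂ _+_ (∑-1 (elements D?)) (cong₂ _+_ (trans (∑-1 (allVectors p m)) (length-allVectors m))
           (trans (∑-1 (steps t)) (List.length-tabulate {n = t} (λ i → suc (toℕ i) mod p)))) ⟨
    ∑ (elements D?) (λ _ → 1) + (∑ (allVectors p m) (λ _ → 1) + ∑ (steps t) (λ _ → 1))
      ≡⟨ cong (∑ (elements D?) (λ _ → 1) +_) (∑-idealList (λ _ → 1)) ⟨
    ∑ (elements D?) (λ _ → 1) + ∑ (idealList m t r) (λ _ → 1)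
      ≡⟨ ∑-split-ideals (λ _ → 1) ⟩
    ∑ (allVectors p n) (λ _ → 1)
      ≡⟨ trans (∑-1 (allVectors p n)) (length-allVectors n) ⟩
    p ^ n
      ∎
    where
    open ≡-Reasoning
    ∑-1 : ∀ {A : Set} (xs : List A) → ∑ xs (λ _ → 1) ≡ length xs
    ∑-1 xs = trans (∑-const xs 1) (ℕ.*-identityʳ (length xs))

  q>0 : 0 < q
  q>0 = ℕ.m^n>0 p m₁

  c>0 : 0 < c
  c>0 = ℕ.m^n>0 p r

  p∸1>0 : 0 < p ∸ 1
  p∸1>0 = ℕ.∸-monoˡ-≤ 1 1<p

  t≤p∸1 : t ≤ p ∸ 1
  t≤p∸1 = ℕ.∸-monoˡ-≤ 1 t<p

  e>0 : 0 < e
  e>0 = ℕ.*-mono-≤ p∸1>0 q>0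

  t≤e : t ≤ e
  t≤e = ℕ.≤-trans t≤p∸1 (ℕ.m≤m*n (p ∸ 1) q {{>-nonZero q>0}})

  e+t<3e : e + t < 3 * e
  e+t<3e = ℕ.+-monoʳ-< e (ℕ.≤-<-trans t≤e (subst (e <_) (sym (cong (e +_) (ℕ.+-identityʳ e))) (ℕ.m<m+n e e>0)))

  T≡e*p*c : T ≡ e * (p * c)
  T≡e*p*c = trans (cong ((p ∸ 1) *_) (ℕ.^-distribˡ-+-* p m₁ (suc r))) (sym (ℕ.*-assoc (p ∸ 1) q (p * c)))

  e+t<T : e + t < T
  e+t<T = begin-strict
    e + t        <⟨ e+t<3e ⟩
    3 * e        ≡⟨ ℕ.*-comm 3 e ⟩
    e * (3 * 1)  ≤⟨ ℕ.*-monoʳ-≤ e (ℕ.*-mono-≤ 2<p c>0) ⟩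
    e * (p * c)  ≡⟨ T≡e*p*c ⟨
    T            ∎
    where open ℕ.≤-Reasoning

  T∸e : (p ∸ 1) * (p ^ (n ∸ 1) ∸ p ^ (m ∸ 1)) ≡ T ∸ e
  T∸e = ℕ.*-distribˡ-∸ (p ∸ 1) (p ^ (n ∸ 1)) q

  d≡T∸[e+t] : d ≡ T ∸ (e + t)
  d≡T∸[e+t] = trans (cong (_∸ t) T∸e) (ℕ.∸-+-assoc T e t)

  d+[e+t]≡T : d + (e + t) ≡ T
  d+[e+t]≡T = trans (cong (_+ (e + t)) d≡T∸[e+t]) (ℕ.m∸n+n≡m (ℕ.<⇒≤ e+t<T))

  d>0 : 0 < d
  d>0 = subst (0 <_) (sym d≡T∸[e+t]) (ℕ.m<n⇒0<n∸m e+t<T)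

  -- The number of steps j for which (-1, …, -1, j, 0, …, 0) is orthogonal to
  -- (u′ , a , u″).
  ν : 𝔽^ p m → Fin p → ℕ
  ν u′ a = ∑ (steps t) (λ j → ⟦ u′ · replicate m (-ₚ 1ₚ) +ₚ j *ₚ a Fin.≟ 0ₚ ⟧)

  W-sum : ∀ u′ a (u″ : 𝔽^ p r) → u′ ++ a ∷ u″ ≢ 0ᵥ →
    W (u′ ++ a ∷ u″) + (∑ (allVectors p m) (λ x → ⟦ ¬? (u′ · x Fin.≟ 0ₚ) ⟧) + t) ≡ T + ν u′ a
  W-sum u′ a u″ u≢0 = begin
    W u + (F + t)          ≡⟨ cong (λ k → W u + (F + k)) steps-complement ⟨
    W u + (F + (S + ν′))   ≡⟨ rearrange (W u) F S ν′ ⟩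
    (W u + (F + S)) + ν′   ≡⟨ cong (_+ ν′) (cong₂ _+_ (wt-map (u ·_) (elements D?)) ideals) ⟩
    (∑ (elements D?) f + ∑ (idealList m t r) f) + ν′
                           ≡⟨ cong (_+ ν′) (∑-split-ideals f) ⟩
    ∑ (allVectors p n) f + ν′
                           ≡⟨ cong (_+ ν′) (hyperplane-complement p-prime u u≢0) ⟩
    T + ν′                 ∎
    where
    open ≡-Reasoning
    u : 𝔽^ p n
    u = u′ ++ a ∷ u″
    f : 𝔽^ p n → ℕ
    f x = ⟦ ¬? (u · x Fin.≟ 0ₚ) ⟧
    b : Fin p
    b = u′ · replicate m (-ₚ 1ₚ)
    F S ν′ : ℕ
    F = ∑ (allVectors p m) (λ x → ⟦ ¬? (u′ · x Fin.≟ 0ₚ) ⟧)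
    S = ∑ (steps t) (λ j → ⟦ ¬? (b +ₚ j *ₚ a Fin.≟ 0ₚ) ⟧)
    ν′ = ν u′ a
    rearrange : ∀ w f s v → w + (f + (s + v)) ≡ (w + (f + s)) + v
    rearrange = solve-∀
    steps-complement : S + ν′ ≡ t
    steps-complement = trans (∑-complement (steps t) (λ j → b +ₚ j *ₚ a Fin.≟ 0ₚ))
                             (List.length-tabulate {n = t} (λ i → suc (toℕ i) mod p))
    flat : ∀ x → u · (x ++ 0ᵥ) ≡ u′ · x
    flat x = trans (·-++ u′ x (a ∷ u″) 0ᵥ) (trans (cong (u′ · x +ₚ_) (·-zeroʳ (a ∷ u″))) (+-identityʳ (u′ · x)))
    step : ∀ j → u · (replicate m (-ₚ 1ₚ) ++ j ∷ 0ᵥ) ≡ b +ₚ j *ₚ a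
    step j = trans (·-++ u′ (replicate m (-ₚ 1ₚ)) (a ∷ u″) (j ∷ 0ᵥ)) (cong (b +ₚ_)
      (trans (cong₂ _+ₚ_ (*ₚ-comm a j) (·-zeroʳ u″)) (+-identityʳ (j *ₚ a))))
    ideals : F + S ≡ ∑ (idealList m t r) f
    ideals = sym (trans (∑-idealList f) (cong₂ _+_
      (∑-cong (allVectors p m) (λ x → cong (λ y → ⟦ ¬? (y Fin.≟ 0ₚ) ⟧) (flat x)))
      (∑-cong (steps t) (λ j → cong (λ y → ⟦ ¬? (y Fin.≟ 0ₚ) ⟧) (step j)))))

  ++≢0ˡ : ∀ {u′ : 𝔽^ p m} {v : 𝔽^ p (suc r)} → u′ ≢ 0ᵥ → u′ ++ v ≢ 0ᵥ
  ++≢0ˡ {u′} u′≢0 eq = u′≢0 (Vec.++-injectiveˡ u′ 0ᵥ (trans eq (0ᵥ-++ m)))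

  ++≢0ʳ : ∀ {u′ : 𝔽^ p m} {v : 𝔽^ p (suc r)} → v ≢ 0ᵥ → u′ ++ v ≢ 0ᵥ
  ++≢0ʳ {u′} v≢0 eq = v≢0 (Vec.++-injectiveʳ u′ 0ᵥ (trans eq (0ᵥ-++ m)))

  W-nonzero : ∀ u′ a (u″ : 𝔽^ p r) → u′ ≢ 0ᵥ → W (u′ ++ a ∷ u″) ≡ d + ν u′ a
  W-nonzero u′ a u″ u′≢0 = ℕ.+-cancelʳ-≡ (e + t) _ _ (begin
    W u + (e + t)         ≡⟨ cong (λ k → W u + (k + t)) (hyperplane-complement p-prime u′ u′≢0) ⟨
    W u + (_ + t)         ≡⟨ W-sum u′ a u″ (++≢0ˡ u′≢0) ⟩
    T + ν u′ a            ≡⟨ cong (_+ ν u′ a) d+[e+t]≡T ⟨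
    d + (e + t) + ν u′ a  ≡⟨ rearrange d (e + t) (ν u′ a) ⟩
    d + ν u′ a + (e + t)  ∎)
    where
    open ≡-Reasoning
    u : 𝔽^ p n
    u = u′ ++ a ∷ u″
    rearrange : ∀ x y z → x + y + z ≡ x + z + y
    rearrange = solve-∀

  W-zero : ∀ {u′} a (u″ : 𝔽^ p r) → u′ ≡ 0ᵥ → a ∷ u″ ≢ 0ᵥ → W (u′ ++ a ∷ u″) ≡ d + e + ν u′ a
  W-zero {u′} a u″ u′≡0 v≢0 = ℕ.+-cancelʳ-≡ t _ _ (begin
    W u + t               ≡⟨ cong (λ k → W u + (k + t)) (∑-none (allVectors p m) (λ x → ¬? (u′ · x Fin.≟ 0ₚ))
                               (λ {x} _ ≢0 → ≢0 (trans (cong (_· x) u′≡0) (·-zeroˡ x)))) ⟨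
    W u + (_ + t)         ≡⟨ W-sum u′ a u″ (++≢0ʳ {u′} v≢0) ⟩
    T + ν u′ a            ≡⟨ cong (_+ ν u′ a) d+[e+t]≡T ⟨
    d + (e + t) + ν u′ a  ≡⟨ rearrange d e t (ν u′ a) ⟩
    d + e + ν u′ a + t    ∎)
    where
    open ≡-Reasoning
    u : 𝔽^ p n
    u = u′ ++ a ∷ u″
    rearrange : ∀ x y z w → x + (y + z) + w ≡ x + y + w + z
    rearrange = solve-∀

  ν-nonzero : ∀ u′ {a} → a ≢ 0ₚ → ν u′ a ≡ 0 ⊎ ν u′ a ≡ 1
  ν-nonzero u′ {a} a≢0 = ∑-atMostOne (λ j → _ +ₚ j *ₚ a Fin.≟ 0ₚ) (steps-unique t<p)
                                     (affineRoot-unique p-prime a≢0)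

  private
    at-zero : ∀ {b a : Fin p} j → a ≡ 0ₚ → b +ₚ j *ₚ a ≡ b
    at-zero {b} j a≡0 = trans (cong (λ a → b +ₚ j *ₚ a) a≡0) (trans (cong (b +ₚ_) (zeroʳ j)) (+-identityʳ b))

  ν-off : ∀ u′ {a} → a ≡ 0ₚ → u′ · replicate m (-ₚ 1ₚ) ≢ 0ₚ → ν u′ a ≡ 0
  ν-off u′ {a} a≡0 b≢0 = ∑-none (steps t) (λ j → _ +ₚ j *ₚ a Fin.≟ 0ₚ)
    (λ {j} _ eq → b≢0 (trans (sym (at-zero j a≡0)) eq))

  ν-on : ∀ u′ {a} → a ≡ 0ₚ → u′ · replicate m (-ₚ 1ₚ) ≡ 0ₚ → ν u′ a ≡ t
  ν-on u′ {a} a≡0 b≡0 = begin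
    ν u′ a                  ≡⟨ ∑-cong (steps t) (λ j → ⟦⟧-yes (_ Fin.≟ 0ₚ) (trans (at-zero j a≡0) b≡0)) ⟩
    ∑ (steps t) (λ _ → 1)   ≡⟨ ∑-const (steps t) 1 ⟩
    length (steps t) * 1    ≡⟨ ℕ.*-identityʳ _ ⟩
    length (steps t)        ≡⟨ List.length-tabulate {n = t} (λ i → suc (toℕ i) mod p) ⟩
    t                       ∎
    where open ≡-Reasoning

  -- For u′ = 0 and a ≠ 0 the only root of j a = 0 is j = 0, which is no step.
  ν-zero : ∀ {u′ a} → u′ ≡ 0ᵥ → a ≢ 0ₚ → ν u′ a ≡ 0
  ν-zero {u′} {a} u′≡0 a≢0 = ∑-none (steps t) (λ j → _ +ₚ j *ₚ a Fin.≟ 0ₚ)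
    (λ j∈ eq → steps-nonzero t<p j∈ (affineRoot-unique p-prime a≢0 eq
      (trans (cong₂ _+ₚ_ (trans (cong (_· replicate m (-ₚ 1ₚ)) u′≡0) (·-zeroˡ (replicate m (-ₚ 1ₚ)))) (zeroˡ a))
             (+ₚ-identityˡ 0ₚ))))

  -- 𝔽ₚⁿ as 𝔽ₚᵐ × 𝔽ₚ × 𝔽ₚʳ.
  Triple : Set
  Triple = 𝔽^ p m × Fin p × 𝔽^ p r

  triples : List Triple
  triples = cartesianProduct (allVectors p m) (cartesianProduct (allFin p) (allVectors p r))

  ∑-triples : ∀ (f : Triple → ℕ) → ∑ triples f ≡
    ∑ (allVectors p m) (λ u′ → ∑ (allFin p) (λ a → ∑ (allVectors p r) (λ u″ → f (u′ , a , u″))))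
  ∑-triples f = trans (∑-cartesianProductWith _,_ (allVectors p m) _ f)
    (∑-cong (allVectors p m) (λ u′ → ∑-cartesianProductWith _,_ (allFin p) (allVectors p r) (λ v → f (u′ , v))))

  ∑-allVectors≡∑-triples : ∀ f → ∑ (allVectors p n) f ≡ ∑ triples (λ (u′ , a , u″) → f (u′ ++ a ∷ u″))
  ∑-allVectors≡∑-triples f = trans (∑-split m f)
    (trans (∑-cong (allVectors p m) (λ u′ → ∑-∷ (λ v → f (u′ ++ v)))) (sym (∑-triples _)))

  ∑-product : ∀ (f : 𝔽^ p m → ℕ) (g : Fin p → ℕ) (h : 𝔽^ p r → ℕ) →
    ∑ triples (λ (u′ , a , u″) → g a * (f u′ * h u″)) ≡
    ∑ (allFin p) g * (∑ (allVectors p m) f * ∑ (allVectors p r) h)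
  ∑-product f g h = begin
    ∑ triples (λ (u′ , a , u″) → g a * (f u′ * h u″))
      ≡⟨ ∑-triples _ ⟩
    ∑ (allVectors p m) (λ u′ → ∑ (allFin p) (λ a → ∑ (allVectors p r) (λ u″ → g a * (f u′ * h u″))))
      ≡⟨ ∑-cong (allVectors p m) (λ u′ → trans
           (∑-cong (allFin p) (λ a → trans (∑-*ˡ (allVectors p r) (g a) _) (cong (g a *_) (∑-*ˡ (allVectors p r) (f u′) h))))
           (∑-*ʳ (allFin p) g (f u′ * H))) ⟩
    ∑ (allVectors p m) (λ u′ → ∑ (allFin p) g * (f u′ * H))
      ≡⟨ trans (∑-*ˡ (allVectors p m) (∑ (allFin p) g) (λ u′ → f u′ * H)) (cong (∑ (allFin p) g *_) (∑-*ʳ (allVectors p m) f H)) ⟩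
    ∑ (allFin p) g * (∑ (allVectors p m) f * H)
      ∎
    where
    open ≡-Reasoning
    H : ℕ
    H = ∑ (allVectors p r) h

  -- The indicator of u′ ≠ 0 and those of the five rows: u′ ≠ 0 and ν = 0; a ≠ 0 and
  -- ν = 1; u′ ≠ 0, a = 0 and the entries of u′ sum to 0; u′ = 0 and a ≠ 0; u′ = 0,
  -- a = 0 and u″ ≠ 0.  In the second, ν itself is the indicator of ν = 1, as a ≠ 0.
  nonzero-head row₁ row₂ row₃ row₄ row₅ : Triple → ℕ
  nonzero-head (u′ , a , u″) = ⟦ ¬? (u′ ≟ᵥ 0ᵥ) ⟧
  row₁ (u′ , a , u″) = ⟦ ¬? (u′ ≟ᵥ 0ᵥ) ⟧ * ⟦ ν u′ a ℕ.≟ 0 ⟧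
  row₂ (u′ , a , u″) = ⟦ ¬? (a Fin.≟ 0ₚ) ⟧ * ν u′ a
  row₃ (u′ , a , u″) = ⟦ a Fin.≟ 0ₚ ⟧ *
    ((⟦ ¬? (u′ ≟ᵥ 0ᵥ) ⟧ * ⟦ u′ · replicate m (-ₚ 1ₚ) Fin.≟ 0ₚ ⟧) * 1)
  row₄ (u′ , a , u″) = ⟦ ¬? (a Fin.≟ 0ₚ) ⟧ * (⟦ u′ ≟ᵥ 0ᵥ ⟧ * 1)
  row₅ (u′ , a , u″) = ⟦ a Fin.≟ 0ₚ ⟧ * (⟦ u′ ≟ᵥ 0ᵥ ⟧ * ⟦ ¬? (u″ ≟ᵥ 0ᵥ) ⟧)

  module _ (u′ : 𝔽^ p m) (a : Fin p) (u″ : 𝔽^ p r) (w : ℕ) where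

    private
      u : 𝔽^ p n
      u = u′ ++ a ∷ u″

      b : Fin p
      b = u′ · replicate m (-ₚ 1ₚ)

      u′≡0⇒b≡0 : u′ ≡ 0ᵥ → b ≡ 0ₚ
      u′≡0⇒b≡0 u′≡0 = trans (cong (_· replicate m (-ₚ 1ₚ)) u′≡0) (·-zeroˡ (replicate m (-ₚ 1ₚ)))

      word : ℕ
      word = ⟦ ¬? (u ≟ᵥ 0ᵥ) ×-dec (W u ℕ.≟ w) ⟧

      word≡ : ∀ {v} → u ≢ 0ᵥ → W u ≡ v → word ≡ ⟦ v ℕ.≟ w ⟧
      word≡ u≢0 refl = ⟦⟧-cong (¬? (u ≟ᵥ 0ᵥ) ×-dec (W u ℕ.≟ w)) (W u ℕ.≟ w) proj₂ (u≢0 ,_)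

      pad : ∀ {x y} → x ≡ y → x ≡ y + 0 + 0
      pad {x} {y} eq = trans eq (sym (trans (ℕ.+-identityʳ (y + 0)) (ℕ.+-identityʳ y)))

      -- The table for u, where k stands for ν.  The decisions are arguments, so that
      -- the indicators compute on matching.
      rows : ∀ k → Dec (u′ ≡ 0ᵥ) → Dec (a ≡ 0ₚ) → Dec (b ≡ 0ₚ) → Dec (u″ ≡ 0ᵥ) → Dec (k ≡ 0) →
        List (ℕ × ℕ)
      rows k z? y? s? o? k? = table d t e
        (⟦ ¬? z? ⟧ * ⟦ k? ⟧) (⟦ ¬? y? ⟧ * k) (⟦ y? ⟧ * ((⟦ ¬? z? ⟧ * ⟦ s? ⟧) * 1))
        (⟦ ¬? y? ⟧ * (⟦ z? ⟧ * 1)) (⟦ y? ⟧ * (⟦ z? ⟧ * ⟦ ¬? o? ⟧))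

      Classified : ∀ k → Dec (u′ ≡ 0ᵥ) → Dec (a ≡ 0ₚ) → Dec (b ≡ 0ₚ) → Dec (u″ ≡ 0ᵥ) → Dec (k ≡ 0) → Set
      Classified k z? y? s? o? k? =
        word ≡ frequency w (rows k z? y? s? o? k?) ×
        ⟦ ¬? z? ⟧ * ⟦ k? ⟧ + (⟦ ¬? y? ⟧ * k + ⟦ y? ⟧ * ((⟦ ¬? z? ⟧ * ⟦ s? ⟧) * 1)) ≡ ⟦ ¬? z? ⟧

      classified : ∀ k → ν u′ a ≡ k → ∀ z? y? s? o? k? → Classified k z? y? s? o? k?
      classified k ν≡k (no u′≢0) (yes a≡0) (yes b≡0) o? (no _) =
        pad (word≡ (++≢0ˡ u′≢0) (trans (W-nonzero u′ a u″ u′≢0) (cong (d +_) (ν-on u′ a≡0 b≡0)))) , refl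
      classified k ν≡k (no u′≢0) (yes a≡0) (yes b≡0) o? (yes k≡0) =
        contradiction (trans (sym (ν-on u′ a≡0 b≡0)) (trans ν≡k k≡0)) (ℕ.>⇒≢ 1≤t)
      classified k ν≡k (no u′≢0) (yes a≡0) (no b≢0) o? (yes _) =
        pad (word≡ (++≢0ˡ u′≢0) (trans (W-nonzero u′ a u″ u′≢0)
              (trans (cong (d +_) (ν-off u′ a≡0 b≢0)) (ℕ.+-identityʳ d)))) , refl
      classified k ν≡k (no u′≢0) (yes a≡0) (no b≢0) o? (no k≢0) =
        contradiction (trans (sym ν≡k) (ν-off u′ a≡0 b≢0)) k≢0
      classified k ν≡k (no u′≢0) (no a≢0) s? o? (yes refl) =
        pad (word≡ (++≢0ˡ u′≢0) (trans (W-nonzero u′ a u″ u′≢0)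
              (trans (cong (d +_) ν≡k) (ℕ.+-identityʳ d)))) , refl
      classified k ν≡k (no u′≢0) (no a≢0) s? o? (no k≢0) = on (ν-nonzero u′ a≢0) ν≡k k≢0
        where
        on : ν u′ a ≡ 0 ⊎ ν u′ a ≡ 1 → ∀ {k} → ν u′ a ≡ k → (k≢0 : k ≢ 0) →
          Classified k (no u′≢0) (no a≢0) s? o? (no k≢0)
        on (inj₁ ν≡0) ν≡k k≢0 = contradiction (trans (sym ν≡k) ν≡0) k≢0
        on (inj₂ ν≡1) {suc zero}    ν≡k k≢0 =
          pad (word≡ (++≢0ˡ u′≢0) (trans (W-nonzero u′ a u″ u′≢0) (cong (d +_) ν≡1))) , refl
        on (inj₂ ν≡1) {zero}        ν≡k k≢0 = contradiction refl k≢0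
        on (inj₂ ν≡1) {suc (suc k)} ν≡k k≢0 = contradiction (trans (sym ν≡k) ν≡1) λ ()
      classified zero ν≡0 (yes u′≡0) (no a≢0) s? o? k? =
        pad (word≡ (++≢0ʳ {u′} v≢0) (trans (W-zero a u″ u′≡0 v≢0)
              (trans (cong (d + e +_) ν≡0) (ℕ.+-identityʳ (d + e))))) , refl
        where
        v≢0 : a ∷ u″ ≢ 0ᵥ
        v≢0 = a≢0 ∘ Vec.∷-injectiveˡ
      classified (suc k) ν≡k (yes u′≡0) (no a≢0) s? o? k? =
        contradiction (trans (sym ν≡k) (ν-zero u′≡0 a≢0)) ℕ.1+n≢0
      classified k ν≡k (yes u′≡0) (yes a≡0) s? (no u″≢0) k? =
        pad (word≡ (++≢0ʳ {u′} v≢0) (trans (W-zero a u″ u′≡0 v≢0)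
              (cong (d + e +_) (ν-on u′ a≡0 (u′≡0⇒b≡0 u′≡0))))) , refl
        where
        v≢0 : a ∷ u″ ≢ 0ᵥ
        v≢0 = u″≢0 ∘ Vec.∷-injectiveʳ
      classified k ν≡k (yes u′≡0) (yes a≡0) s? (yes u″≡0) k? =
        ⟦⟧-no (¬? (u ≟ᵥ 0ᵥ) ×-dec (W u ℕ.≟ w)) (λ (u≢0 , _) → u≢0
          (trans (cong₂ _++_ u′≡0 (cong₂ _∷_ a≡0 u″≡0)) (sym (0ᵥ-++ m)))) , refl

      classification : Classified (ν u′ a) (u′ ≟ᵥ 0ᵥ) (a Fin.≟ 0ₚ) (b Fin.≟ 0ₚ) (u″ ≟ᵥ 0ᵥ) (ν u′ a ℕ.≟ 0)
      classification = 
        classified (ν u′ a) refl (u′ ≟ᵥ 0ᵥ) (a Fin.≟ 0ₚ) (b Fin.≟ 0ₚ) (u″ ≟ᵥ 0ᵥ) (ν u′ a ℕ.≟ 0)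

    word-frequency : ⟦ ¬? (u′ ++ a ∷ u″ ≟ᵥ 0ᵥ) ×-dec (W (u′ ++ a ∷ u″) ℕ.≟ w) ⟧ ≡
      frequency w (table d t e (row₁ (u′ , a , u″)) (row₂ (u′ , a , u″)) (row₃ (u′ , a , u″))
                               (row₄ (u′ , a , u″)) (row₅ (u′ , a , u″)))
    word-frequency = proj₁ classification

    rows-nonzero : row₁ (u′ , a , u″) + (row₂ (u′ , a , u″) + row₃ (u′ , a , u″)) ≡ nonzero-head (u′ , a , u″)
    rows-nonzero = proj₂ classification

  word-count : ∀ w → ∑ (allVectors p n) (λ u → ⟦ ¬? (u ≟ᵥ 0ᵥ) ×-dec (W u ℕ.≟ w) ⟧) ≡
    frequency w (table d t e (∑ triples row₁) (∑ triples row₂) (∑ triples row₃) (∑ triples row₄) (∑ triples row₅))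
  word-count w = trans (∑-allVectors≡∑-triples _)
    (trans (∑-cong triples (λ (u′ , a , u″) → word-frequency u′ a u″ w))
           (∑-frequency-table triples d t e w row₁ row₂ row₃ row₄ row₅))

  ∑-a≡0 : ∑ (allFin p) (λ a → ⟦ a Fin.≟ 0ₚ ⟧) ≡ 1
  ∑-a≡0 = ∑-unique (Fin._≟ 0ₚ) (Unique.allFin⁺ p) (λ x≡0 y≡0 → trans x≡0 (sym y≡0)) (∈-allFin 0ₚ) refl

  ∑-a≢0 : ∑ (allFin p) (λ a → ⟦ ¬? (a Fin.≟ 0ₚ) ⟧) ≡ p ∸ 1
  ∑-a≢0 = ℕ.+-cancelʳ-≡ 1 _ _ (begin
    ∑ (allFin p) (λ a → ⟦ ¬? (a Fin.≟ 0ₚ) ⟧) + 1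
      ≡⟨ cong (∑ (allFin p) (λ a → ⟦ ¬? (a Fin.≟ 0ₚ) ⟧) +_) ∑-a≡0 ⟨
    ∑ (allFin p) (λ a → ⟦ ¬? (a Fin.≟ 0ₚ) ⟧) + ∑ (allFin p) (λ a → ⟦ a Fin.≟ 0ₚ ⟧)
      ≡⟨ ∑-complement (allFin p) (Fin._≟ 0ₚ) ⟩
    length (allFin p)   ≡⟨ List.length-tabulate {n = p} id ⟩
    p                   ≡⟨ ℕ.m∸n+n≡m (>-nonZero⁻¹ p) ⟨
    p ∸ 1 + 1           ∎)
    where open ≡-Reasoning

  ∑-1 : ∀ k → ∑ (allVectors p k) (λ _ → 1) ≡ p ^ k
  ∑-1 k = trans (∑-const (allVectors p k) 1) (trans (ℕ.*-identityʳ _) (length-allVectors k))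

  ones≢0 : replicate m (-ₚ 1ₚ) ≢ 0ᵥ
  ones≢0 eq = -1ₚ≢0 1<p (Vec.∷-injectiveˡ eq)

  size₅ : ∑ triples row₅ ≡ c ∸ 1
  size₅ = begin
    ∑ triples row₅   ≡⟨ ∑-product _ _ _ ⟩
    _                ≡⟨ cong₂ (λ x y → x * (y * N)) ∑-a≡0 (∑-zero-vector m) ⟩
    1 * (1 * N)      ≡⟨ trans (ℕ.*-identityˡ _) (ℕ.*-identityˡ N) ⟩
    N                ≡⟨ ℕ.m+n∸n≡m N 1 ⟨
    N + 1 ∸ 1        ≡⟨ cong (_∸ 1) (∑-nonzero-vectors r) ⟩
    c ∸ 1            ∎
    where
    open ≡-Reasoning
    N : ℕ
    N = ∑ (allVectors p r) (λ u″ → ⟦ ¬? (u″ ≟ᵥ 0ᵥ) ⟧)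

  size₄ : ∑ triples row₄ ≡ (p ∸ 1) * c
  size₄ = begin
    ∑ triples row₄       ≡⟨ ∑-product _ _ _ ⟩
    _                    ≡⟨ cong₂ (λ x y → x * y) ∑-a≢0 (cong₂ _*_ (∑-zero-vector m) (∑-1 r)) ⟩
    (p ∸ 1) * (1 * c)    ≡⟨ cong ((p ∸ 1) *_) (ℕ.*-identityˡ c) ⟩
    (p ∸ 1) * c          ∎
    where open ≡-Reasoning

  size₃ : ∑ triples row₃ ≡ (q ∸ 1) * c
  size₃ = begin
    ∑ triples row₃       ≡⟨ ∑-product _ _ _ ⟩
    _                    ≡⟨ cong₂ (λ x y → x * y) ∑-a≡0 (cong₂ _*_ on-hyperplane (∑-1 r)) ⟩
    1 * ((q ∸ 1) * c)    ≡⟨ ℕ.*-identityˡ _ ⟩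
    (q ∸ 1) * c          ∎
    where
    open ≡-Reasoning
    V : List (𝔽^ p m)
    V = allVectors p m
    s? : ∀ u′ → Dec (u′ · replicate m (-ₚ 1ₚ) ≡ 0ₚ)
    s? u′ = u′ · replicate m (-ₚ 1ₚ) Fin.≟ 0ₚ
    X : ℕ
    X = ∑ V (λ u′ → ⟦ ¬? (u′ ≟ᵥ 0ᵥ) ⟧ * ⟦ s? u′ ⟧)
    pointwise : ∀ u′ (z? : Dec (u′ ≡ 0ᵥ)) → ⟦ ¬? z? ⟧ * ⟦ s? u′ ⟧ + ⟦ z? ⟧ ≡ ⟦ replicate m (-ₚ 1ₚ) · u′ Fin.≟ 0ₚ ⟧
    pointwise u′ (no _)    = trans (ℕ.+-identityʳ _) (trans (ℕ.*-identityˡ _)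
                               (cong (λ x → ⟦ x Fin.≟ 0ₚ ⟧) (·-comm u′ (replicate m (-ₚ 1ₚ)))))
    pointwise u′ (yes u≡0) = sym (⟦⟧-yes (_ Fin.≟ 0ₚ)
                               (trans (cong (replicate m (-ₚ 1ₚ) ·_) u≡0) (·-zeroʳ (replicate m (-ₚ 1ₚ)))))
    on-hyperplane : X ≡ q ∸ 1
    on-hyperplane = begin
      X                                         ≡⟨ ℕ.m+n∸n≡m X 1 ⟨
      X + 1 ∸ 1                                 ≡⟨ cong (λ k → X + k ∸ 1) (∑-zero-vector m) ⟨
      X + ∑ V (λ u′ → ⟦ u′ ≟ᵥ 0ᵥ ⟧) ∸ 1         ≡⟨ cong (_∸ 1) (∑-+ V _ _) ⟨
      ∑ V (λ u′ → ⟦ ¬? (u′ ≟ᵥ 0ᵥ) ⟧ * ⟦ s? u′ ⟧ + ⟦ u′ ≟ᵥ 0ᵥ ⟧) ∸ 1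
                                                ≡⟨ cong (_∸ 1) (∑-cong V (λ u′ → pointwise u′ (u′ ≟ᵥ 0ᵥ))) ⟩
      ∑ V (λ u′ → ⟦ replicate m (-ₚ 1ₚ) · u′ Fin.≟ 0ₚ ⟧) ∸ 1
                                                ≡⟨ cong (_∸ 1) (hyperplane₀ p-prime (replicate m (-ₚ 1ₚ)) ones≢0) ⟩
      q ∸ 1                                     ∎

  -- For fixed a ≠ 0, each of the t steps j contributes an affine hyperplane of
  -- p^(m-1) vectors u′.
  size₂ : ∑ triples row₂ ≡ (p ∸ 1) * c * t * q
  size₂ = begin
    ∑ triples row₂
      ≡⟨ ∑-triples row₂ ⟩
    ∑ V (λ u′ → ∑ (allFin p) (λ a → ∑ (allVectors p r) (λ _ → y a * ν u′ a)))
      ≡⟨ ∑-cong V (λ u′ → ∑-cong (allFin p) (λ a → trans (∑-const (allVectors p r) _)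
           (cong (_* (y a * ν u′ a)) (length-allVectors r)))) ⟩
    ∑ V (λ u′ → ∑ (allFin p) (λ a → c * (y a * ν u′ a)))
      ≡⟨ ∑-swap V (allFin p) _ ⟩
    ∑ (allFin p) (λ a → ∑ V (λ u′ → c * (y a * ν u′ a)))
      ≡⟨ ∑-cong (allFin p) (λ a → trans (∑-*ˡ V c _) (cong (c *_) (trans (∑-*ˡ V (y a) _) (cong (y a *_) (∑-ν a))))) ⟩
    ∑ (allFin p) (λ a → c * (y a * (t * q)))
      ≡⟨ trans (∑-*ˡ (allFin p) c _) (cong (c *_) (∑-*ʳ (allFin p) y (t * q))) ⟩
    c * (∑ (allFin p) y * (t * q))
      ≡⟨ cong (λ k → c * (k * (t * q))) ∑-a≢0 ⟩
    c * ((p ∸ 1) * (t * q))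
      ≡⟨ rearrange c (p ∸ 1) t q ⟩
    (p ∸ 1) * c * t * q
      ∎
    where
    open ≡-Reasoning
    V : List (𝔽^ p m)
    V = allVectors p m
    y : Fin p → ℕ
    y a = ⟦ ¬? (a Fin.≟ 0ₚ) ⟧
    rearrange : ∀ c p t q → c * (p * (t * q)) ≡ p * c * t * q
    rearrange = solve-∀
    ∑-ν : ∀ a → ∑ V (λ u′ → ν u′ a) ≡ t * q
    ∑-ν a = begin
      ∑ V (λ u′ → ν u′ a)
        ≡⟨ ∑-swap V (steps t) _ ⟩
      ∑ (steps t) (λ j → ∑ V (λ u′ → ⟦ u′ · replicate m (-ₚ 1ₚ) +ₚ j *ₚ a Fin.≟ 0ₚ ⟧))
        ≡⟨ ∑-cong (steps t) (λ j → trans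
             (∑-cong V (λ u′ → cong (λ x → ⟦ x Fin.≟ 0ₚ ⟧)
               (trans (+ₚ-comm _ (j *ₚ a)) (cong (j *ₚ a +ₚ_) (·-comm u′ (replicate m (-ₚ 1ₚ)))))))
             (hyperplane p-prime (replicate m (-ₚ 1ₚ)) ones≢0 (j *ₚ a))) ⟩
      ∑ (steps t) (λ _ → q)
        ≡⟨ ∑-const (steps t) q ⟩
      length (steps t) * q
        ≡⟨ cong (_* q) (List.length-tabulate {n = t} (λ i → suc (toℕ i) mod p)) ⟩
      t * q
        ∎

  size₁₂₃ : ∑ triples row₁ + (∑ triples row₂ + ∑ triples row₃) ≡ (p * q ∸ 1) * (p * c)
  size₁₂₃ = begin
    ∑ triples row₁ + (∑ triples row₂ + ∑ triples row₃)
      ≡⟨ cong (∑ triples row₁ +_) (∑-+ triples row₂ row₃) ⟨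
    ∑ triples row₁ + ∑ triples (λ x → row₂ x + row₃ x)
      ≡⟨ ∑-+ triples row₁ (λ x → row₂ x + row₃ x) ⟨
    ∑ triples (λ x → row₁ x + (row₂ x + row₃ x))
      ≡⟨ ∑-cong triples (λ (u′ , a , u″) → rows-nonzero u′ a u″ 0) ⟩
    ∑ triples nonzero-head
      ≡⟨ ∑-triples nonzero-head ⟩
    ∑ V (λ u′ → ∑ (allFin p) (λ _ → ∑ (allVectors p r) (λ _ → z u′)))
      ≡⟨ ∑-cong V (λ u′ → trans (∑-allFin-const _) (trans (cong (p *_)
           (trans (∑-const (allVectors p r) (z u′)) (cong (_* z u′) (length-allVectors r)))) (rearrange p c (z u′)))) ⟩
    ∑ V (λ u′ → z u′ * (p * c))
      ≡⟨ ∑-*ʳ V z (p * c) ⟩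
    ∑ V z * (p * c)
      ≡⟨ cong (_* (p * c)) (trans (sym (ℕ.m+n∸n≡m (∑ V z) 1)) (cong (_∸ 1) (∑-nonzero-vectors m))) ⟩
    (p * q ∸ 1) * (p * c)
      ∎
    where
    open ≡-Reasoning
    V : List (𝔽^ p m)
    V = allVectors p m
    z : 𝔽^ p m → ℕ
    z u′ = ⟦ ¬? (u′ ≟ᵥ 0ᵥ) ⟧
    rearrange : ∀ p c z → p * (c * z) ≡ z * (p * c)
    rearrange = solve-∀

  size₁ : ∑ triples row₁ ≡ (p ∸ 1) * c * ((p ∸ t + 1) * q ∸ 1)
  size₁ = ℕ.+-cancelʳ-≡ ((p ∸ 1) * c * t * q + (q ∸ 1) * c) _ _ (begin
    ∑ triples row₁ + ((p ∸ 1) * c * t * q + (q ∸ 1) * c)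
      ≡⟨ cong (∑ triples row₁ +_) (cong₂ _+_ size₂ size₃) ⟨
    ∑ triples row₁ + (∑ triples row₂ + ∑ triples row₃)
      ≡⟨ size₁₂₃ ⟩
    (p * q ∸ 1) * (p * c)
      ≡⟨ identity (p ∸ 1) (p ∸ t) (q ∸ 1) t c 1+p₁≡p (trans (ℕ.m∸n+n≡m (ℕ.<⇒≤ t<p)) (sym 1+p₁≡p)) 1+q₁≡q ⟩
    (p ∸ 1) * c * ((p ∸ t + 1) * q ∸ 1) + ((p ∸ 1) * c * t * q + (q ∸ 1) * c)
      ∎)
    where
    open ≡-Reasoning
    1+p₁≡p : suc (p ∸ 1) ≡ p
    1+p₁≡p = trans (ℕ.+-comm 1 (p ∸ 1)) (ℕ.m∸n+n≡m (>-nonZero⁻¹ p))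
    1+q₁≡q : suc (q ∸ 1) ≡ q
    1+q₁≡q = trans (ℕ.+-comm 1 (q ∸ 1)) (ℕ.m∸n+n≡m q>0)
    -- Here p = p₁ + 1 = s + t and q = q₁ + 1.
    identity : ∀ p₁ s q₁ t c {p q} → suc p₁ ≡ p → s + t ≡ suc p₁ → suc q₁ ≡ q →
      (p * q ∸ 1) * (p * c) ≡ p₁ * c * ((s + 1) * q ∸ 1) + (p₁ * c * t * q + q₁ * c)
    identity p₁ s q₁ t c refl s+t≡p refl = begin
      (q₁ + p₁ * suc q₁) * (suc p₁ * c)
        ≡⟨ expand p₁ q₁ c ⟩
      p₁ * c * (suc p₁ * suc q₁ + q₁) + q₁ * c
        ≡⟨ cong (λ k → p₁ * c * (k * suc q₁ + q₁) + q₁ * c) s+t≡p ⟨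
      p₁ * c * ((s + t) * suc q₁ + q₁) + q₁ * c
        ≡⟨ regroup p₁ s q₁ t c ⟩
      p₁ * c * (s * suc q₁ + q₁) + (p₁ * c * t * suc q₁ + q₁ * c)
        ≡⟨ cong (λ k → p₁ * c * k + (p₁ * c * t * suc q₁ + q₁ * c)) (cong (_∸ 1) (predecessor s q₁)) ⟩
      p₁ * c * ((s + 1) * suc q₁ ∸ 1) + (p₁ * c * t * suc q₁ + q₁ * c)
        ∎
      where
      expand : ∀ p₁ q₁ c → (q₁ + p₁ * suc q₁) * (suc p₁ * c) ≡ p₁ * c * (suc p₁ * suc q₁ + q₁) + q₁ * c
      expand = solve-∀
      regroup : ∀ p₁ s q₁ t c → p₁ * c * ((s + t) * suc q₁ + q₁) + q₁ * c ≡
        p₁ * c * (s * suc q₁ + q₁) + (p₁ * c * t * suc q₁ + q₁ * c)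
      regroup = solve-∀
      predecessor : ∀ s q₁ → suc (s * suc q₁ + q₁) ≡ (s + 1) * suc q₁
      predecessor = solve-∀

  -- The weight table, with the weights expressed by d, t and e.
  rows : List (ℕ × ℕ)
  rows = table d t e
    ((p ∸ 1) * c * ((p ∸ t + 1) * q ∸ 1)) ((p ∸ 1) * c * t * q) ((q ∸ 1) * c) ((p ∸ 1) * c) (c ∸ 1)

  T∸e≡d+t : (p ∸ 1) * (p ^ (n ∸ 1) ∸ p ^ (m ∸ 1)) ≡ d + t
  T∸e≡d+t = trans T∸e (trans (cong (_∸ e) (trans (sym d+[e+t]≡T) (rearrange d e t))) (ℕ.m+n∸n≡m (d + t) e))
    where
    rearrange : ∀ d e t → d + (e + t) ≡ d + t + e
    rearrange = solve-∀

  weightTable≡rows : weightTable p m n t ≡ rows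
  weightTable≡rows = begin
    weightTable p m n t
      ≡⟨⟩
    with-weights (p ^ (n ∸ m ∸ 1)) ((p ∸ 1) * (p ^ (n ∸ 1) ∸ q)) (T ∸ t) T
      ≡⟨ cong (λ k → with-weights (p ^ k) ((p ∸ 1) * (p ^ (n ∸ 1) ∸ q)) (T ∸ t) T) (cong (_∸ 1) (ℕ.m+n∸m≡n m (suc r))) ⟩
    with-weights c ((p ∸ 1) * (p ^ (n ∸ 1) ∸ q)) (T ∸ t) T
      ≡⟨ cong (λ x → with-weights c x (T ∸ t) T) T∸e≡d+t ⟩
    with-weights c (d + t) (T ∸ t) T
      ≡⟨ cong₂ (with-weights c (d + t)) fourth fifth ⟩
    rows
      ∎
    where
    open ≡-Reasoning
    with-weights : (c w₃ w₄ w₅ : ℕ) → List (ℕ × ℕ)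
    with-weights c w₃ w₄ w₅ = (d , (p ∸ 1) * c * ((p ∸ t + 1) * q ∸ 1)) ∷ (d + 1 , (p ∸ 1) * c * t * q) ∷
      (w₃ , (q ∸ 1) * c) ∷ (w₄ , (p ∸ 1) * c) ∷ (w₅ , c ∸ 1) ∷ []
    fifth : T ≡ d + e + t
    fifth = trans (sym d+[e+t]≡T) (sym (ℕ.+-assoc d e t))
    fourth : T ∸ t ≡ d + e
    fourth = trans (cong (_∸ t) fifth) (ℕ.m+n∸n≡m (d + e) t)

  by-parts : (P : 𝔽^ p n → Set) → (∀ u′ a u″ → P (u′ ++ a ∷ u″)) → ∀ u → P u
  by-parts P parts u = subst P (Vec.take++drop≡id m u) (on (Vec.drop m u))
    where
    on : ∀ v → P (Vec.take m u ++ v)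
    on (a ∷ u″) = parts (Vec.take m u) a u″

  W≥d : ∀ u → u ≢ 0ᵥ → d ≤ W u
  W≥d = by-parts (λ u → u ≢ 0ᵥ → d ≤ W u) (λ u′ a u″ → on u′ a u″ (u′ ≟ᵥ 0ᵥ))
    where
    on : ∀ u′ a u″ → Dec (u′ ≡ 0ᵥ) → u′ ++ a ∷ u″ ≢ 0ᵥ → d ≤ W (u′ ++ a ∷ u″)
    on u′ a u″ (no u′≢0)  _   = subst (d ≤_) (sym (W-nonzero u′ a u″ u′≢0)) (ℕ.m≤m+n d (ν u′ a))
    on u′ a u″ (yes u′≡0) u≢0 = subst (d ≤_)
      (sym (W-zero a u″ u′≡0 (λ v≡0 → u≢0 (trans (cong₂ _++_ u′≡0 v≡0) (sym (0ᵥ-++ m))))))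
      (ℕ.≤-trans (ℕ.m≤m+n d e) (ℕ.m≤m+n (d + e) (ν u′ a)))

  W≤T : ∀ u → W u ≤ T
  W≤T u = on (u ≟ᵥ 0ᵥ)
    where
    open ℕ.≤-Reasoning
    f : 𝔽^ p n → ℕ
    f x = ⟦ ¬? (u · x Fin.≟ 0ₚ) ⟧
    on : Dec (u ≡ 0ᵥ) → W u ≤ T
    on (yes u≡0) = begin
      W u                       ≡⟨ cong wt (trans (cong (codeword D?) u≡0) (codeword-0ᵥ D?)) ⟩
      wt (0ᵥ {n = length (elements D?)})
                                ≡⟨ wt-0ᵥ (length (elements D?)) ⟩
      0                         ≤⟨ z≤n ⟩
      T                         ∎
    on (no u≢0) = begin
      W u                                        ≡⟨ wt-map (u ·_) (elements D?) ⟩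
      ∑ (elements D?) f                          ≤⟨ ℕ.m≤m+n _ _ ⟩
      ∑ (elements D?) f + ∑ (idealList m t r) f  ≡⟨ ∑-split-ideals f ⟩
      ∑ (allVectors p n) f                       ≡⟨ hyperplane-complement p-prime u u≢0 ⟩
      T                                          ∎

  words-of-weight : ∀ w → HasSize (λ x → 𝒞 D? x × x ≢ 0ᵥ × wt x ≡ w) (frequency w rows)
  words-of-weight w = subst (HasSize (λ x → 𝒞 D? x × x ≢ 0ᵥ × wt x ≡ w))
    (trans (word-count w) (cong (frequency w) (table-cong d t e size₁ size₂ size₃ size₄ size₅)))
    (𝒞-weightDistribution D? d>0 W≥d w)

  weightDistribution : HasNonzeroWeights (𝒞 D?) (weightTable p (suc m₁) (suc m₁ + suc r) t)
  weightDistribution w = subst (HasSize (λ x → 𝒞 D? x × x ≢ 0ᵥ × wt x ≡ w))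
    (sym (trans (sum-filter≡frequency w (weightTable p m n t)) (cong (frequency w) weightTable≡rows)))
    (words-of-weight w)

  -- The row accounts for codewords of weight w.
  Occurs : ℕ → ℕ × ℕ → Set
  Occurs w row = proj₁ row ≡ w × 0 < proj₂ row

  nonzeroWeight⇔occurs : ∀ w → IsNonzeroWeight (𝒞 D?) w ⇔ Any (Occurs w) rows
  nonzeroWeight⇔occurs w = mk⇔
    (positive⇒occurs w rows ∘ inhabited⇒positiveSize (words-of-weight w))
    (positiveSize⇒inhabited (words-of-weight w) ∘ occurs⇒positive w)

  -- An increasing list of weights, each in a row of positive frequency, which
  -- contains the weight of each such row, consists of all weights.
  weights-size : ∀ ws → Linked _<_ ws → All (λ w → Any (Occurs w) rows) ws →
    (∀ {w} → Any (Occurs w) rows → w ∈ ws) → HasSize (IsNonzeroWeight (𝒞 D?)) (length ws)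
  weights-size ws increasing occurring complete =
    ws , AllPairs.map ℕ.<⇒≢ (Linked⇒AllPairs ℕ.<-trans increasing) , (λ w → mk⇔
      (λ w∈ → Equivalence.from (nonzeroWeight⇔occurs w) (All.lookup occurring w∈))
      (complete ∘ Equivalence.to (nonzeroWeight⇔occurs w))) , refl

  q>1 : 1 < q
  q>1 = ℕ.<-≤-trans 1<p (subst (_≤ q) (ℕ.*-identityʳ p) (ℕ.^-monoʳ-≤ p 1≤m₁))

  t<e : t < e
  t<e = ℕ.≤-<-trans t≤p∸1 (ℕ.m<m*n (p ∸ 1) q {{>-nonZero p∸1>0}} q>1)

  f₁>0 : 0 < (p ∸ 1) * c * ((p ∸ t + 1) * q ∸ 1)
  f₁>0 = ℕ.*-mono-≤ (ℕ.*-mono-≤ p∸1>0 c>0)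
    (ℕ.∸-monoˡ-≤ 1 (ℕ.*-mono-≤ (ℕ.+-monoˡ-≤ 1 (ℕ.m<n⇒0<n∸m t<p)) q>0))

  f₂>0 : 0 < (p ∸ 1) * c * t * q
  f₂>0 = ℕ.*-mono-≤ (ℕ.*-mono-≤ (ℕ.*-mono-≤ p∸1>0 c>0) 1≤t) q>0

  f₃>0 : 0 < (q ∸ 1) * c
  f₃>0 = ℕ.*-mono-≤ (ℕ.m<n⇒0<n∸m q>1) c>0

  f₄>0 : 0 < (p ∸ 1) * c
  f₄>0 = ℕ.*-mono-≤ p∸1>0 c>0

  f₅>0 : 1 ≤ r → 0 < c ∸ 1
  f₅>0 1≤r = ℕ.m<n⇒0<n∸m (ℕ.<-≤-trans 1<p (subst (_≤ c) (ℕ.*-identityʳ p) (ℕ.^-monoʳ-≤ p 1≤r)))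

  ¬f₅>0 : r ≡ 0 → ¬ 0 < c ∸ 1
  ¬f₅>0 r≡0 0<f₅ = ℕ.<⇒≢ 0<f₅ (sym (cong (λ k → p ^ k ∸ 1) r≡0))

  d+1<d+t : 2 ≤ t → d + 1 < d + t
  d+1<d+t 2≤t = ℕ.+-monoʳ-< d 2≤t

  d+t<d+e : d + t < d + e
  d+t<d+e = ℕ.+-monoʳ-< d t<e

  d+1<d+e : d + 1 < d + e
  d+1<d+e = ℕ.+-monoʳ-< d (ℕ.≤-<-trans 1≤t t<e)

  d<d+1 : d < d + 1
  d<d+1 = ℕ.m<m+n d (s≤s z≤n)

  d+e<d+e+t : d + e < d + e + t
  d+e<d+e+t = ℕ.m<m+n (d + e) 1≤t

  private
    occurs₁ : Any (Occurs d) rows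
    occurs₁ = here (refl , f₁>0)
    occurs₂ : Any (Occurs (d + 1)) rows
    occurs₂ = there (here (refl , f₂>0))
    occurs₃ : Any (Occurs (d + t)) rows
    occurs₃ = there (there (here (refl , f₃>0)))
    occurs₄ : Any (Occurs (d + e)) rows
    occurs₄ = there (there (there (here (refl , f₄>0))))
    occurs₅ : 1 ≤ r → Any (Occurs (d + e + t)) rows
    occurs₅ 1≤r = there (there (there (there (here (refl , f₅>0 1≤r)))))

  fiveWeights : 2 ≤ t → 1 ≤ r → HasSize (IsNonzeroWeight (𝒞 D?)) 5
  fiveWeights 2≤t 1≤r = weights-size (d ∷ d + 1 ∷ d + t ∷ d + e ∷ d + e + t ∷ [])
    (d<d+1 ∷ d+1<d+t 2≤t ∷ d+t<d+e ∷ d+e<d+e+t ∷ [-])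
    (occurs₁ ∷ occurs₂ ∷ occurs₃ ∷ occurs₄ ∷ occurs₅ 1≤r ∷ []) λ where
      (here (refl , _))                                 → here refl
      (there (here (refl , _)))                         → there (here refl)
      (there (there (here (refl , _))))                 → there (there (here refl))
      (there (there (there (here (refl , _)))))         → there (there (there (here refl)))
      (there (there (there (there (here (refl , _)))))) → there (there (there (there (here refl))))

  fourWeights : 2 ≤ t → r ≡ 0 → HasSize (IsNonzeroWeight (𝒞 D?)) 4
  fourWeights 2≤t r≡0 = weights-size (d ∷ d + 1 ∷ d + t ∷ d + e ∷ [])
    (d<d+1 ∷ d+1<d+t 2≤t ∷ d+t<d+e ∷ [-])
    (occurs₁ ∷ occurs₂ ∷ occurs₃ ∷ occurs₄ ∷ []) λ where
      (here (refl , _))                                → here refl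
      (there (here (refl , _)))                        → there (here refl)
      (there (there (here (refl , _))))                → there (there (here refl))
      (there (there (there (here (refl , _)))))        → there (there (there (here refl)))
      (there (there (there (there (here (_ , f₅>0)))))) → contradiction f₅>0 (¬f₅>0 r≡0)

  fourWeights₁ : t ≡ 1 → 1 ≤ r → HasSize (IsNonzeroWeight (𝒞 D?)) 4
  fourWeights₁ t≡1 1≤r = weights-size (d ∷ d + 1 ∷ d + e ∷ d + e + t ∷ [])
    (d<d+1 ∷ d+1<d+e ∷ d+e<d+e+t ∷ [-])
    (occurs₁ ∷ occurs₂ ∷ occurs₄ ∷ occurs₅ 1≤r ∷ []) λ where
      (here (refl , _))                                 → here refl
      (there (here (refl , _)))                         → there (here refl)
      (there (there (here (refl , _))))                 → there (here (cong (d +_) t≡1))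
      (there (there (there (here (refl , _)))))         → there (there (here refl))
      (there (there (there (there (here (refl , _)))))) → there (there (there (here refl)))

  threeWeights₁ : t ≡ 1 → r ≡ 0 → HasSize (IsNonzeroWeight (𝒞 D?)) 3
  threeWeights₁ t≡1 r≡0 = weights-size (d ∷ d + 1 ∷ d + e ∷ [])
    (d<d+1 ∷ d+1<d+e ∷ [-])
    (occurs₁ ∷ occurs₂ ∷ occurs₄ ∷ []) λ where
      (here (refl , _))                                → here refl
      (there (here (refl , _)))                        → there (here refl)
      (there (there (here (refl , _))))                → there (here (cong (d +_) t≡1))
      (there (there (there (here (refl , _)))))        → there (there (here refl))
      (there (there (there (there (here (_ , f₅>0)))))) → contradiction f₅>0 (¬f₅>0 r≡0)

  third-weight : t ≡ 1 → d + 1 ≡ (p ∸ 1) * (p ^ (n ∸ 1) ∸ p ^ (m ∸ 1))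
  third-weight t≡1 = trans (cong (d +_) (sym t≡1)) (sym T∸e≡d+t)

-- The Griesmer bound and minimality

  code-minDistance : HasMinDistance (𝒞 D?) d
  code-minDistance = on (Equivalence.from (nonzeroWeight⇔occurs d) (here (refl , f₁>0)))
    where
    on : IsNonzeroWeight (𝒞 D?) d → HasMinDistance (𝒞 D?) d
    on (_ , (u , x≡cu) , _ , wt≡d) = 𝒞-minDistance D? d>0 W≥d u (trans (cong wt (sym x≡cu)) wt≡d)

  code-isCode : Is[ p ^ n ∸ p ^ m ∸ t , n , d ]Code (𝒞 D?)
  code-isCode = record
    { linear      = 𝒞-linear D?
    ; codeLength  = trans (sym (ℕ.m+n∸n≡m (length (elements D?)) (p ^ m + t)))
                          (trans (cong (_∸ (p ^ m + t)) length-elements) (sym (ℕ.∸-+-assoc (p ^ n) (p ^ m) t)))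
    ; dimension   = 𝒞-dimension D? d>0 W≥d
    ; minDistance = code-minDistance }

  minimal : 1 ≤ r → IsMinimal (𝒞 D?)
  minimal 1≤r = ashikhminBarg D? d>0 W≥d p-prime W≤T (ℕ.+-cancelʳ-< (p * (e + t)) _ _ (begin-strict
    (p ∸ 1) * T + p * (e + t)  <⟨ ℕ.+-monoʳ-< ((p ∸ 1) * T) gap ⟩
    (p ∸ 1) * T + T            ≡⟨ cong ((p ∸ 1) * T +_) (ℕ.*-identityˡ T) ⟨
    (p ∸ 1) * T + 1 * T        ≡⟨ ℕ.*-distribʳ-+ T (p ∸ 1) 1 ⟨
    (p ∸ 1 + 1) * T            ≡⟨ cong (_* T) (ℕ.m∸n+n≡m (>-nonZero⁻¹ p)) ⟩
    p * T                      ≡⟨ cong (p *_) d+[e+t]≡T ⟨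
    p * (d + (e + t))          ≡⟨ ℕ.*-distribˡ-+ p d (e + t) ⟩
    p * d + p * (e + t)        ∎))
    where
    open ℕ.≤-Reasoning
    p≤c : p ≤ c
    p≤c = subst (_≤ c) (ℕ.*-identityʳ p) (ℕ.^-monoʳ-≤ p 1≤r)
    rearrange : ∀ p c e → p * (c * e) ≡ e * (p * c)
    rearrange = solve-∀
    gap : p * (e + t) < T
    gap = begin-strict
      p * (e + t)   <⟨ ℕ.*-monoʳ-< p e+t<3e ⟩
      p * (3 * e)   ≤⟨ ℕ.*-monoʳ-≤ p (ℕ.*-monoˡ-≤ e (ℕ.≤-trans 2<p p≤c)) ⟩
      p * (c * e)   ≡⟨ rearrange p c e ⟩
      e * (p * c)   ≡⟨ T≡e*p*c ⟨
      T             ∎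

  -- If r = 0, every vector of D has a nonzero last coordinate, so the codeword
  -- of the last unit vector has full support.  The codeword of (-1, …, -1) is no
  -- multiple of it.
  not-minimal : r ≡ 0 → ¬ IsMinimal (𝒞 D?)
  not-minimal r≡0 all-minimal = absurd (proj₂ (proj₂
    (all-minimal (codeword D? last) (last , refl) (last≢0 ∘ codeword-nonzero D? d>0 W≥d)))
    (codeword D? (replicate n (-ₚ 1ₚ))) (replicate n (-ₚ 1ₚ) , refl)
    (λ {i} _ → ∈supp⁺ (codeword D? last) (full-support i)))
    where
    last : 𝔽^ p n
    last = 0ᵥ {n = m} ++ 1ₚ ∷ 0ᵥ
    absurd : ¬ (∃ λ a → codeword D? (replicate n (-ₚ 1ₚ)) ≡ a ⊙ codeword D? last)
    absurd (a , eq) = -1ₚ≢0 1<p (trans (Vec.∷-injectiveˡ (codeword-injective D? d>0 W≥d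
      (trans eq (sym (codeword-⊙ D? a last))))) (zeroʳ a))
    empty≡0 : ∀ {k} → k ≡ 0 → (v : 𝔽^ p k) → v ≡ 0ᵥ
    empty≡0 refl [] = refl
    1≢0 : 1ₚ ≢ 0ₚ {p}
    1≢0 1≡0 = ℕ.1+n≢0 (trans (sym (toℕ-mod-< 1<p)) (trans (cong toℕ 1≡0) toℕ-0ₚ))
    last≢0 : last ≢ 0ᵥ
    last≢0 = ++≢0ʳ {0ᵥ} (1≢0 ∘ Vec.∷-injectiveˡ)
    last-nonzero : ∀ x → x ∈ elements D? → last · x ≢ 0ₚ
    last-nonzero = by-parts (λ x → x ∈ elements D? → last · x ≢ 0ₚ) λ x′ b x″ x∈ last·x≡0 →
      Equivalence.to (D⇔∉ideals _) (proj₂ (∈-filter⁻ D? {xs = allVectors p n} x∈)) (∈-++⁺ˡ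
          (subst (λ v → x′ ++ v ∈ map (_++ 0ᵥ) (allVectors p m))
                 (cong₂ _∷_ (sym (last-coordinate x′ b x″ last·x≡0)) (sym (empty≡0 r≡0 x″)))
                 (∈-map⁺ (_++ 0ᵥ) (allVectors-complete x′))))
      where
      open ≡-Reasoning
      last-coordinate : ∀ x′ b x″ → last · (x′ ++ b ∷ x″) ≡ 0ₚ → b ≡ 0ₚ
      last-coordinate x′ b x″ last·x≡0 = begin
        b                                ≡⟨ *ₚ-identityˡ b ⟨
        1ₚ *ₚ b                          ≡⟨ +-identityʳ (1ₚ *ₚ b) ⟨
        1ₚ *ₚ b +ₚ 0ₚ                    ≡⟨ cong (1ₚ *ₚ b +ₚ_) (·-zeroˡ x″) ⟨
        (1ₚ ∷ 0ᵥ) · (b ∷ x″)             ≡⟨ +ₚ-identityˡ ((1ₚ ∷ 0ᵥ) · (b ∷ x″)) ⟨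
        0ₚ +ₚ (1ₚ ∷ 0ᵥ) · (b ∷ x″)       ≡⟨ cong (_+ₚ (1ₚ ∷ 0ᵥ) · (b ∷ x″)) (·-zeroˡ x′) ⟨
        0ᵥ · x′ +ₚ (1ₚ ∷ 0ᵥ) · (b ∷ x″)  ≡⟨ ·-++ 0ᵥ x′ (1ₚ ∷ 0ᵥ) (b ∷ x″) ⟨
        last · (x′ ++ b ∷ x″)            ≡⟨ last·x≡0 ⟩
        0ₚ                               ∎
    full-support : ∀ i → lookup (codeword D? last) i ≢ 0ₚ
    full-support = entries (elements D?) last-nonzero
      where
      entries : ∀ xs → (∀ x → x ∈ xs → last · x ≢ 0ₚ) →
        ∀ i → lookup (Vec.map (last ·_) (Vec.fromList xs)) i ≢ 0ₚ
      entries (x ∷ xs) nonzero zero    = nonzero x (here refl)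
      entries (x ∷ xs) nonzero (suc i) = entries xs (λ y → nonzero y ∘ there) i

  t<q : t < q
  t<q = ℕ.<-≤-trans t<p (subst (_≤ q) (ℕ.*-identityʳ p) (ℕ.^-monoʳ-≤ p 1≤m₁))

  -- The term of index i + 1 of the Griesmer bound.
  term : ℕ → ℕ
  term i = _/_ (d + (p ^ suc i ∸ 1)) (p ^ suc i) {{ℕ.m^n≢0 p (suc i)}}

  -- The terms telescope against p^(n-1-i) and p^(m-1-i), where n - 1 is written
  -- m₁ + suc r.  Rounding d up to a multiple of p^(i+1) adds t if i + 1 < m, and
  -- e + t otherwise; the latter is less than p^m.
  term-step : ∀ i → i < m₁ + suc r →
    term i + p ^ (m₁ + suc r ∸ suc i) + p ^ (m₁ ∸ i) ≡ p ^ (m₁ + suc r ∸ i) + p ^ (m₁ ∸ suc i)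
  term-step i i<N = trans (on (i ℕ.<? m₁)) (cong (λ k → p ^ k + H) (sym (∸-step i<N)))
    where
    open ≡-Reasoning
    N X H : ℕ
    N = m₁ + suc r
    X = p ^ (N ∸ suc i)
    H = p ^ (m₁ ∸ suc i)
    ∸-step : ∀ {k} → i < k → k ∸ i ≡ suc (k ∸ suc i)
    ∸-step i<k = ℕ.+-∸-assoc 1 i<k
    p≡ : suc (p ∸ 1) ≡ p
    p≡ = trans (ℕ.+-comm 1 (p ∸ 1)) (ℕ.m∸n+n≡m (>-nonZero⁻¹ p))
    power : ∀ {k} → i < k → p ^ (k ∸ suc i) * p ^ suc i ≡ p ^ k
    power {k} i<k = trans (sym (ℕ.^-distribˡ-+-* p (k ∸ suc i) (suc i))) (cong (p ^_) (ℕ.m∸n+n≡m i<k))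
    term≡ : ∀ {s} k → k * p ^ suc i ≡ d + s → s < p ^ suc i → term i ≡ k
    term≡ k = ceiling {{ℕ.m^n≢0 p (suc i)}} k
    on : Dec (i < m₁) → term i + X + p ^ (m₁ ∸ i) ≡ p * X + H
    on (yes i<m₁) = begin
      term i + X + p ^ (m₁ ∸ i)              ≡⟨ cong₂ (λ k l → k + X + p ^ l) (term≡ k k*b≡d+t t<b) (∸-step i<m₁) ⟩
      k + X + p * H                          ≡⟨ cong (λ l → k + X + l * H) p≡ ⟨
      k + X + suc (p ∸ 1) * H                ≡⟨ rearrange k X H (p ∸ 1) ⟩
      (k + (p ∸ 1) * H) + X + H              ≡⟨ cong (λ l → l + X + H) k+≡ ⟩
      (p ∸ 1) * X + X + H                    ≡⟨ cong (_+ H) (ℕ.+-comm ((p ∸ 1) * X) X) ⟩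
      suc (p ∸ 1) * X + H                    ≡⟨ cong (λ l → l * X + H) p≡ ⟩
      p * X + H                              ∎
      where
      k : ℕ
      k = (p ∸ 1) * (X ∸ H)
      rearrange : ∀ k X H p → k + X + suc p * H ≡ (k + p * H) + X + H
      rearrange = solve-∀
      H≤X : H ≤ X
      H≤X = ℕ.^-monoʳ-≤ p (ℕ.∸-monoˡ-≤ (suc i) (ℕ.m≤m+n m₁ (suc r)))
      k+≡ : k + (p ∸ 1) * H ≡ (p ∸ 1) * X
      k+≡ = trans (sym (ℕ.*-distribˡ-+ (p ∸ 1) (X ∸ H) H)) (cong ((p ∸ 1) *_) (ℕ.m∸n+n≡m H≤X))
      k*b≡d+t : k * p ^ suc i ≡ d + t
      k*b≡d+t = begin
        (p ∸ 1) * (X ∸ H) * p ^ suc i              ≡⟨ ℕ.*-assoc (p ∸ 1) (X ∸ H) (p ^ suc i) ⟩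
        (p ∸ 1) * ((X ∸ H) * p ^ suc i)            ≡⟨ cong ((p ∸ 1) *_) (ℕ.*-distribʳ-∸ (p ^ suc i) X H) ⟩
        (p ∸ 1) * (X * p ^ suc i ∸ H * p ^ suc i)  ≡⟨ cong₂ (λ x y → (p ∸ 1) * (x ∸ y)) (power i<N) (power i<m₁) ⟩
        (p ∸ 1) * (p ^ N ∸ q)                      ≡⟨ T∸e≡d+t ⟩
        d + t                                      ∎
      t<b : t < p ^ suc i
      t<b = ℕ.<-≤-trans t<p (subst (_≤ p ^ suc i) (ℕ.*-identityʳ p) (ℕ.^-monoʳ-≤ p {1} {suc i} (s≤s z≤n)))
    on (no i≮m₁) = begin
      term i + X + p ^ (m₁ ∸ i)   ≡⟨ cong₂ (λ k l → k + X + p ^ l) (term≡ ((p ∸ 1) * X) k*b≡ e+t<b)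
                                       (trans (ℕ.m≤n⇒m∸n≡0 m₁≤i) (sym (ℕ.m≤n⇒m∸n≡0 (ℕ.m≤n⇒m≤1+n m₁≤i)))) ⟩
      (p ∸ 1) * X + X + H         ≡⟨ cong (_+ H) (ℕ.+-comm ((p ∸ 1) * X) X) ⟩
      suc (p ∸ 1) * X + H         ≡⟨ cong (λ l → l * X + H) p≡ ⟩
      p * X + H                   ∎
      where
      m₁≤i : m₁ ≤ i
      m₁≤i = ℕ.≮⇒≥ i≮m₁
      k*b≡ : (p ∸ 1) * X * p ^ suc i ≡ d + (e + t)
      k*b≡ = trans (ℕ.*-assoc (p ∸ 1) X (p ^ suc i)) (trans (cong ((p ∸ 1) *_) (power i<N)) (sym d+[e+t]≡T))
      e+t<b : e + t < p ^ suc i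
      e+t<b = ℕ.<-≤-trans (subst (e + t <_) (trans (ℕ.+-comm e q) (cong (_* q) p≡)) (ℕ.+-monoʳ-< e t<q))
                          (ℕ.^-monoʳ-≤ p (s≤s m₁≤i))

  griesmer-sum : p ^ n ∸ p ^ m ∸ t ≡
    sum (map (λ i → _/_ (d + (p ^ i ∸ 1)) (p ^ i) {{ℕ.m^n≢0 p i}}) (upTo n))
  griesmer-sum = begin
    p ^ n ∸ p ^ m ∸ t                          ≡⟨ cong (λ k → k ∸ p ^ m ∸ t) p^n≡ ⟩
    d + S + t + p ^ m ∸ p ^ m ∸ t              ≡⟨ cong (_∸ t) (ℕ.m+n∸n≡m (d + S + t) (p ^ m)) ⟩
    d + S + t ∸ t                              ≡⟨ ℕ.m+n∸n≡m (d + S) t ⟩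
    d + S                                      ≡⟨ cong (_+ S) (trans (n/1≡n (d + 0)) (ℕ.+-identityʳ d)) ⟨
    sum (applyUpTo (λ i → _/_ (d + (p ^ i ∸ 1)) (p ^ i) {{ℕ.m^n≢0 p i}}) n)
                                               ≡⟨ cong sum (List.map-upTo _ n) ⟨
    sum (map (λ i → _/_ (d + (p ^ i ∸ 1)) (p ^ i) {{ℕ.m^n≢0 p i}}) (upTo n))
                                               ∎
    where
    open ≡-Reasoning
    N S : ℕ
    N = m₁ + suc r
    S = sum (applyUpTo term N)
    p≡ : p ≡ p ∸ 1 + 1
    p≡ = sym (ℕ.m∸n+n≡m (>-nonZero⁻¹ p))
    times-p : ∀ k → p * k ≡ (p ∸ 1) * k + k
    times-p k = trans (cong (_* k) p≡) (trans (ℕ.*-distribʳ-+ k (p ∸ 1) 1) (cong ((p ∸ 1) * k +_) (ℕ.*-identityˡ k)))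
    S+q : S + q ≡ p ^ N
    S+q = ℕ.+-cancelʳ-≡ 1 _ _ (begin
      S + q + 1               ≡⟨ rearrange S q 1 ⟩
      S + 1 + q               ≡⟨ cong (λ k → S + p ^ k + q) (ℕ.n∸n≡0 N) ⟨
      S + p ^ (N ∸ N) + q     ≡⟨ telescope N term (λ i → p ^ (N ∸ i)) (λ i → p ^ (m₁ ∸ i)) term-step ⟩
      p ^ N + p ^ (m₁ ∸ N)    ≡⟨ cong (λ k → p ^ N + p ^ k) (ℕ.m≤n⇒m∸n≡0 (ℕ.m≤m+n m₁ (suc r))) ⟩
      p ^ N + 1               ∎)
      where
      rearrange : ∀ x y z → x + y + z ≡ x + z + y
      rearrange = solve-∀
    p^n≡ : p ^ n ≡ d + S + t + p ^ m
    p^n≡ = begin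
      p * p ^ N                ≡⟨ times-p (p ^ N) ⟩
      T + p ^ N                ≡⟨ cong₂ _+_ d+[e+t]≡T S+q ⟨
      d + (e + t) + (S + q)    ≡⟨ rearrange d e t S q ⟩
      d + S + t + (e + q)      ≡⟨ cong (d + S + t +_) (times-p q) ⟨
      d + S + t + p * q        ∎
      where
      rearrange : ∀ d e t S q → d + (e + t) + (S + q) ≡ d + S + t + (e + q)
      rearrange = solve-∀

  code-isGriesmer : IsGriesmer[ p ^ (suc m₁ + suc r) ∸ p ^ suc m₁ ∸ t , suc m₁ + suc r , minDist p (suc m₁) (suc m₁ + suc r) t ] (𝒞 D?)
  code-isGriesmer = record { isCode = code-isCode ; griesmer = griesmer-sum }

  n∸2≡m₁+r : n ∸ 2 ≡ m₁ + r
  n∸2≡m₁+r = cong (_∸ 1) (ℕ.+-suc m₁ r)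

  r≥1⇒m≤n∸2 : 1 ≤ r → m ≤ n ∸ 2
  r≥1⇒m≤n∸2 1≤r = subst (m ≤_) (sym n∸2≡m₁+r) (subst (_≤ m₁ + r) (ℕ.+-comm m₁ 1) (ℕ.+-monoʳ-≤ m₁ 1≤r))

  m≤n∸2⇒r≥1 : m ≤ n ∸ 2 → 1 ≤ r
  m≤n∸2⇒r≥1 m≤n∸2 = ℕ.+-cancelˡ-≤ m₁ 1 r (subst (_≤ m₁ + r) (ℕ.+-comm 1 m₁) (subst (m ≤_) n∸2≡m₁+r m≤n∸2))

  m≡n∸1⇒r≡0 : m ≡ n ∸ 1 → r ≡ 0
  m≡n∸1⇒r≡0 m≡n∸1 = sym (ℕ.+-cancelˡ-≡ m 0 r (trans (ℕ.+-identityʳ m) (trans m≡n∸1 (ℕ.+-suc m₁ r))))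

  minimal⇔ : IsMinimal (𝒞 D?) ⇔ m ≤ n ∸ 2
  minimal⇔ = mk⇔ (λ all-minimal → r≥1⇒m≤n∸2 (ℕ.n≢0⇒n>0 (λ r≡0 → not-minimal r≡0 all-minimal))) (minimal ∘ m≤n∸2⇒r≥1)

2<oddPrime : ∀ {p} → Prime p → ¬ (2 ∣ p) → 2 < p
2<oddPrime {p} p-prime 2∤p = ℕ.≤∧≢⇒< (nonTrivial⇒n>1 p {{prime⇒nonTrivial p-prime}}) λ { refl → 2∤p (divides 1 refl) }

n≡m+suc : ∀ {m n} → 3 ≤ n → m ≤ n ∸ 1 → ∃ λ r → n ≡ m + suc r
n≡m+suc {m} {suc n} _ m≤n = n ∸ m , trans (cong suc (sym (ℕ.m+[n∸m]≡n m≤n))) (sym (ℕ.+-suc m (n ∸ m)))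

-- The asserted properties, as a predicate which can be transported along an
-- equation for n.
Conclusion : (p m n t : ℕ) .{{_ : NonZero p}} → Set
Conclusion p m n t =
  let
    I : 𝔽^ p n
    I = idealI m t
    C = 𝒞 (∁? (ideals? m I))
    d = minDist p m n t
  in
  IsSaturated m I ×
  (∀ x → Ideals m I x ⇔ ExplicitIdeals m t x) ×
  IsGriesmer[ p ^ n ∸ p ^ m ∸ t , n , d ] C ×
  HasNonzeroWeights C (weightTable p m n t) ×
  (2 ≤ t → m ≤ n ∸ 2 → HasSize (IsNonzeroWeight C) 5) ×
  (2 ≤ t → m ≡ n ∸ 1 → HasSize (IsNonzeroWeight C) 4) ×
  (t ≡ 1 → d + 1 ≡ (p ∸ 1) * (p ^ (n ∸ 1) ∸ p ^ (m ∸ 1))) ×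
  (t ≡ 1 → m ≤ n ∸ 2 → HasSize (IsNonzeroWeight C) 4) ×
  (t ≡ 1 → m ≡ n ∸ 1 → HasSize (IsNonzeroWeight C) 3) ×
  (IsMinimal C ⇔ m ≤ n ∸ 2)

conclusion : ∀ {p m₁ r t} .{{_ : NonZero p}} → Prime p → 2 < p → 1 ≤ m₁ → 1 ≤ t → t < p →
  Conclusion p (suc m₁) (suc m₁ + suc r) t
conclusion {p} {m₁} {r} {t} p-prime 2<p 1≤m₁ 1≤t t<p =
    I-saturated 1<p m<n t<p 1≤t
  , (λ x → mk⇔ (ideal⇒explicit 1<p m<n t<p x) (explicit⇒ideal 1<p m<n t<p x))
  , code-isGriesmer
  , weightDistribution
  , (λ 2≤t m≤n∸2 → fiveWeights 2≤t (m≤n∸2⇒r≥1 m≤n∸2))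
  , (λ 2≤t m≡n∸1 → fourWeights 2≤t (m≡n∸1⇒r≡0 m≡n∸1))
  , third-weight
  , (λ t≡1 m≤n∸2 → fourWeights₁ t≡1 (m≤n∸2⇒r≥1 m≤n∸2))
  , (λ t≡1 m≡n∸1 → threeWeights₁ t≡1 (m≡n∸1⇒r≡0 m≡n∸1))
  , minimal⇔
  where
  m<n : suc m₁ < suc m₁ + suc r
  m<n = ℕ.m<m+n (suc m₁) (s≤s z≤n)
  1<p : 1 < p
  1<p = ℕ.<-trans (s≤s (s≤s z≤n)) 2<p
  complement : ∀ x → (¬ Ideals (suc m₁) (idealI (suc m₁) t) x) ⇔ (¬ x ∈ idealList (suc m₁) t r)
  complement x = mk⇔
    (_∘ explicit⇒ideal 1<p m<n t<p x ∘ Equivalence.to (idealList⇔explicit (suc m₁) t r x))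
    (_∘ Equivalence.from (idealList⇔explicit (suc m₁) t r x) ∘ ideal⇒explicit 1<p m<n t<p x)
  open Weights p-prime 2<p m₁ r t 1≤m₁ 1≤t t<p (∁? (ideals? (suc m₁) (idealI (suc m₁) t))) complement hiding (1<p)

theorem4p4 : (p m n t : ℕ) .{{_ : NonZero p}} →
    Prime p → ¬ (2 ∣ p) →
    2 ≤ m → m ≤ n ∸ 1 → 3 ≤ n →
    1 ≤ t → t ≤ p ∸ 1 →
    let
      I : 𝔽^ p n
      I = idealI m t
      C = 𝒞 (∁? (ideals? m I))
      d = minDist p m n t
    in
    IsSaturated m I ×
    (∀ x → Ideals m I x ⇔ ExplicitIdeals m t x) ×
    IsGriesmer[ p ^ n ∸ p ^ m ∸ t , n , d ] C ×
    HasNonzeroWeights C (weightTable p m n t) ×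
    (2 ≤ t → m ≤ n ∸ 2 → HasSize (IsNonzeroWeight C) 5) ×
    (2 ≤ t → m ≡ n ∸ 1 → HasSize (IsNonzeroWeight C) 4) ×
    (t ≡ 1 → d + 1 ≡ (p ∸ 1) * (p ^ (n ∸ 1) ∸ p ^ (m ∸ 1))) ×
    (t ≡ 1 → m ≤ n ∸ 2 → HasSize (IsNonzeroWeight C) 4) ×
    (t ≡ 1 → m ≡ n ∸ 1 → HasSize (IsNonzeroWeight C) 3) ×
    (IsMinimal C ⇔ m ≤ n ∸ 2)
theorem4p4 p (suc m₁) n t p-prime 2∤p (s≤s 1≤m₁) m≤n∸1 3≤n 1≤t t≤p∸1 =
  subst (λ n → Conclusion p (suc m₁) n t) (sym (proj₂ split))
    (conclusion {r = proj₁ split} p-prime (2<oddPrime p-prime 2∤p) 1≤m₁ 1≤t (ℕ.≤-<-trans t≤p∸1 p∸1<p))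
  where
  split : ∃ λ r → n ≡ suc m₁ + suc r
  split = n≡m+suc 3≤n m≤n∸1
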